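{- Every tree-cograph $G$ is b-continuous; that is, $G$ admits a b-coloring with exactly $t$ colors for every integer $t$ with $\chi(G)\le t\le \chi_b(G)$.
   Context: Graphs are finite and simple. For vertex-disjoint graphs $G_1=(V_1,E_1)$ and $G_2=(V_2,E_2)$, the union is $G_1\cup G_2=(V_1\cup V_2,E_1\cup E_2)$, and the join $G_1\vee G_2$ is obtained from the union by adding all edges between $V_1$ and $V_2$. A co-tree is a graph whose complement is a tree. Tree-cographs are defined recursively: a graph $G$ is a tree-cograph if and only if (i) $G$ is a tree or a co-tree, or (ii) $G$ is the union of two tree-cographs, or (iii) $G$ is the join of two tree-cographs. A b-coloring of a graph with $t$ colors is a proper coloring of the vertices with $t$ colors such that every color class contains a vertex that is adjacent to all other $t-1$ color classes. $\chi(G)$ is the chromatic number, and the b-chromatic number $\chi_b(G)$ is the maximum $t$ such that $G$ admits a b-coloring with $t$ colors. -}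

module Defs where

open import Data.Fin using (Fin)
open import Data.Fin.Properties using (+↔⊎) renaming (_≟_ to _≟ᶠ_)
open import Data.List using (_∷_; _∷ʳ_; length)
open import Data.List.Relation.Unary.Linked using (Linked)
open import Data.List.Relation.Unary.Unique.Propositional using (Unique)
open import Data.Nat using (ℕ; _+_; _≤_)
open import Data.Product using (∃; ∃-syntax; _×_; _,_)
open import Data.Sum using (_⊎_; inj₁; inj₂)
open import Data.Sum.Function.Propositional using (_⊎-↔_)
open import Data.Sum.Relation.Binary.Pointwise
  using (Pointwise; ⊎-symmetric; ⊎-decidable; inj₁; inj₂)
open import Data.Unit using (⊤; tt)
open import Function using (_∘_)
open import Function.Bundles using (Inverse; _↔_; _⇔_)
open import Function.Construct.Composition using (_↔-∘_)
open import Function.Construct.Symmetry using (↔-sym)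
open import Function.Properties.Inverse using (↔⇒↣)
open import Level using (0ℓ)
open import Relation.Binary.Construct.Closure.ReflexiveTransitive using (Star)
open import Relation.Binary.Core using (Rel)
open import Relation.Binary.Definitions
  using (Decidable; DecidableEquality; Irreflexive; Symmetric)
open import Relation.Binary.PropositionalEquality using (_≡_; _≢_; refl; sym)
open import Relation.Nullary using (¬_; yes; ¬?; _×-dec_)
open import Relation.Nullary.Decidable using (via-injection)

record Graph : Set₁ where
  field
    Vertex : Set
    order  : ℕ
    finite : Vertex ↔ Fin order
    Adj    : Rel Vertex 0ℓ
    adj?   : Decidable Adj
    symm   : Symmetric Adj
    irrefl : Irreflexive _≡_ Adj

  _≟_ : DecidableEquality Vertex
  _≟_ = via-injection (↔⇒↣ finite) _≟ᶠ_

open Graph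

record _≅_ (G H : Graph) : Set where
  field
    vertices : Vertex G ↔ Vertex H

  open Inverse vertices public using (to; from)

  field
    adjacency : ∀ u v → Adj G u v ⇔ Adj H (to u) (to v)

complement : Graph → Graph
complement G = record
  { Vertex = Vertex G
  ; order  = order G
  ; finite = finite G
  ; Adj    = λ u v → u ≢ v × ¬ Adj G u v
  ; adj?   = λ u v → ¬? (_≟_ G u v) ×-dec ¬? (adj? G u v)
  ; symm   = λ (u≢v , ¬uv) → u≢v ∘ sym , ¬uv ∘ symm G
  ; irrefl = λ u≡v (u≢v , _) → u≢v u≡v
  }

⊎-finite : (G H : Graph) → (Vertex G ⊎ Vertex H) ↔ Fin (order G + order H)
⊎-finite G H = ↔-sym +↔⊎ ↔-∘ (finite G ⊎-↔ finite H)

infixr 6 _∪_ _∨_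

_∪_ : Graph → Graph → Graph
G ∪ H = record
  { Vertex = Vertex G ⊎ Vertex H
  ; order  = order G + order H
  ; finite = ⊎-finite G H
  ; Adj    = Pointwise (Adj G) (Adj H)
  ; adj?   = ⊎-decidable (adj? G) (adj? H)
  ; symm   = ⊎-symmetric (symm G) (symm H)
  ; irrefl = λ { refl (inj₁ p) → irrefl G refl p
               ; refl (inj₂ p) → irrefl H refl p }
  }

JoinAdj : (G H : Graph) → Rel (Vertex G ⊎ Vertex H) 0ℓ
JoinAdj G H (inj₁ u) (inj₁ v) = Adj G u v
JoinAdj G H (inj₂ u) (inj₂ v) = Adj H u v
JoinAdj G H (inj₁ u) (inj₂ v) = ⊤
JoinAdj G H (inj₂ u) (inj₁ v) = ⊤

_∨_ : Graph → Graph → Graph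
G ∨ H = record
  { Vertex = Vertex G ⊎ Vertex H
  ; order  = order G + order H
  ; finite = ⊎-finite G H
  ; Adj    = JoinAdj G H
  ; adj?   = λ { (inj₁ u) (inj₁ v) → adj? G u v
               ; (inj₂ u) (inj₂ v) → adj? H u v
               ; (inj₁ u) (inj₂ v) → yes tt
               ; (inj₂ u) (inj₁ v) → yes tt }
  ; symm   = λ { {inj₁ u} {inj₁ v} p → symm G p
               ; {inj₂ u} {inj₂ v} p → symm H p
               ; {inj₁ u} {inj₂ v} _ → tt
               ; {inj₂ u} {inj₁ v} _ → tt }
  ; irrefl = λ { {inj₁ u} refl p → irrefl G refl p
               ; {inj₂ u} refl p → irrefl H refl p }
  }

Connected : Graph → Set
Connected G = Vertex G × (∀ u v → Star (Adj G) u v)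

-- A cycle u, v₁, …, vₖ, u: the vertices u, v₁, …, vₖ are distinct and k ≥ 2.
HasCycle : Graph → Set
HasCycle G = ∃[ u ] ∃[ vs ]
  2 ≤ length vs × Unique (u ∷ vs) × Linked (Adj G) (u ∷ (vs ∷ʳ u))

IsTree : Graph → Set
IsTree G = Connected G × ¬ HasCycle G

IsCoTree : Graph → Set
IsCoTree G = IsTree (complement G)

-- _∪_ and _∨_ build concrete vertex types (disjoint sums), so "G is the
-- union (join) of G₁ and G₂" is read up to isomorphism.
data TreeCograph (G : Graph) : Set₁ where
  tree   : IsTree G → TreeCograph G
  cotree : IsCoTree G → TreeCograph G
  union  : ∀ {G₁ G₂} → TreeCograph G₁ → TreeCograph G₂ →
           G ≅ (G₁ ∪ G₂) → TreeCograph G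
  join   : ∀ {G₁ G₂} → TreeCograph G₁ → TreeCograph G₂ →
           G ≅ (G₁ ∨ G₂) → TreeCograph G

Coloring : Graph → ℕ → Set
Coloring G t = Vertex G → Fin t

module _ (G : Graph) {t : ℕ} (c : Coloring G t) where

  IsProper : Set
  IsProper = ∀ {u v} → Adj G u v → c u ≢ c v

  -- v has a neighbour in every colour class other than its own.
  IsBVertex : Vertex G → Set
  IsBVertex v = ∀ j → j ≢ c v → ∃[ w ] Adj G v w × c w ≡ j

  IsBColoring : Set
  IsBColoring = IsProper × (∀ i → ∃[ v ] c v ≡ i × IsBVertex v)

Colorable : Graph → ℕ → Set
Colorable G t = ∃ λ (c : Coloring G t) → IsProper G c

BColorable : Graph → ℕ → Set
BColorable G t = ∃ λ (c : Coloring G t) → IsBColoring G c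

IsChromaticNumber : Graph → ℕ → Set
IsChromaticNumber G χ = Colorable G χ × (∀ t → Colorable G t → χ ≤ t)

IsBChromaticNumber : Graph → ℕ → Set
IsBChromaticNumber G χᵇ = BColorable G χᵇ × (∀ t → BColorable G t → t ≤ χᵇ)

BContinuous : Graph → Set
BContinuous G = ∀ χ χᵇ → IsChromaticNumber G χ → IsBChromaticNumber G χᵇ →
  ∀ t → χ ≤ t → t ≤ χᵇ → BColorable G t

{-# OPTIONS --safe #-}
module Submission where

-- It suffices that a b-coloring with t + 1 colours yields one with t colours
-- whenever G is t-colourable; this property passes to unions and joins.  The
-- recurring tool is that a colour class without b-vertices can be dissolved
-- while all b-vertices of other colours survive.  For a join the palette
-- splits between the two parts.  For a tree one starts afresh from t vertices
-- of degree at least t, and colours top-down.  For a co-tree the colour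
-- classes form a matching of the tree, which is enlarged along an alternating
-- path chosen so that every class keeps a b-vertex.

open import Defs
open import Data.Bool using (Bool; true; false; not) renaming (_≟_ to _≟ᵇ_)
open import Data.Bool.Properties using (not-¬)
open import Data.Fin
  using (Fin; zero; suc; punchIn; punchOut; inject≤; _↑ˡ_; _↑ʳ_; splitAt)
open import Data.Fin.Permutation
  using (Permutation′; transpose; inverseˡ; inverseʳ; _⟨$⟩ʳ_; _⟨$⟩ˡ_)
open import Data.Fin.Properties
  using (any?; all?; injective⇒≤; ¬∀⟶∃¬; punchIn-punchOut; punchIn-injective;
    punchInᵢ≢i; inject≤-injective; suc-injective; ↑ˡ-injective; ↑ʳ-injective;
    splitAt-↑ˡ; splitAt-↑ʳ; splitAt⁻¹-↑ˡ; splitAt⁻¹-↑ʳ)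
  renaming (_≟_ to _≟ᶠ_)
open import Data.List
  using (List; []; _∷_; length; lookup; filter; take; tabulate; _∷ʳ_; allFin; map;
    _++_)
open import Data.List.Membership.Propositional using (_∈_)
open import Data.List.Membership.Propositional.Properties
  using (∈-lookup; ∈-filter⁺; ∈-filter⁻; ∈-tabulate⁺; ∈-allFin; ∈-map⁺; ∈-++⁺ˡ;
    ∈-++⁺ʳ; ∈-++⁻)
import Data.List.Membership.Setoid.Properties as Setoidₘ
open import Data.List.Properties using (filter-notAll; length-map; length-++)
open import Data.List.Relation.Unary.All as All using (All; []; _∷_)
open import Data.List.Relation.Unary.AllPairs using ([]; _∷_)
open import Data.List.Relation.Unary.Any as Any using (here; there)
open import Data.List.Relation.Unary.Linked as Linked using (Linked; [-]; _∷_)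
open import Data.List.Relation.Unary.Unique.Propositional using (Unique)
open import Data.List.Relation.Unary.Unique.Propositional.Properties
  using (tabulate⁺; take⁺; filter⁺; allFin⁺; ++⁺)
open import Data.Nat using (ℕ; zero; suc; pred; _+_; _≤_; _<_; z≤n; s≤s; s≤s⁻¹)
open import Data.Nat.Properties
  using (<⇒≢; <-asym; <-cmp; ≤∧≢⇒<; _≤?_; +-cancelˡ-<; ≤-refl; ≤-trans; m≤n⇒m<n∨m≡n;
    m≤n⇒m≤1+n; n≤1+n; +-mono-≤; +-suc; <⇒≤; ≮⇒≥; _<?_; 1+n≰n; m≤m+n)
  renaming (_≟_ to _≟ⁿ_)
open import Data.Product using (∃; ∃-syntax; ∃₂; _×_; _,_; proj₁; proj₂)
open import Data.Sum as Sum using (_⊎_; inj₁; inj₂; [_,_]′)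
open import Data.Sum.Relation.Binary.Pointwise using (inj₁; inj₂)
open import Data.Unit using (tt)
open import Function using (_∘_; id; case_of_)
open import Function.Bundles using (Inverse; Injection; Equivalence; mk⇔)
open import Function.Construct.Symmetry using (↔-sym)
open import Function.Properties.Inverse using (↔⇒↣)
open import Relation.Binary.Definitions using (DecidableEquality; tri<; tri≈; tri>)
open import Relation.Binary.PropositionalEquality
  using (setoid; _≡_; _≢_; refl; sym; trans; cong; subst; subst₂; ≢-sym)
open import Relation.Nullary
  using (_⊎-dec_; Dec; yes; no; ¬_; ¬?; contradiction; _×-dec_; _→-dec_)
open import Relation.Nullary.Decidable using (map′; decidable-stable; dec-true; dec-false)
open import Relation.Unary using (Decidable)

open Graph using (Vertex; order; finite; Adj; adj?; symm; irrefl)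

-- `DownStep` is b-continuity without its two extremal numbers, so each way of building G can be
-- treated separately. Its premise that G is t-colourable enters in every case: it colours the other
-- part of a union, shows by pigeonhole which part of a join can lose a colour, rules out the clique
-- left when the search in a co-tree gets stuck, and excludes an edge under a one-colour palette in
-- a tree. The obstacle in a co-tree is that moving colours can destroy b-vertices; domination is
-- therefore tested only against the singleton classes of the original colouring, a test that the
-- shifts leave intact. In a tree the given colouring contributes its t + 1 b-vertices. Each has
-- degree at least t, one more than a b-colouring with t colours asks for, and the surplus makes up
-- for the parent: the children alone can show every other colour.

-- Searching finite graphs

module _ (G : Graph) where

  index : Vertex G → Fin (order G)
  index = Inverse.to (finite G)

  vertex : Fin (order G) → Vertex G
  vertex = Inverse.from (finite G)

  vertex-index : ∀ v → vertex (index v) ≡ v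
  vertex-index v = Inverse.inverseʳ (finite G) refl

  index-vertex : ∀ i → index (vertex i) ≡ i
  index-vertex i = Inverse.inverseˡ (finite G) refl

  index-injective : ∀ {u v} → index u ≡ index v → u ≡ v
  index-injective {u} {v} eq =
    trans (sym (vertex-index u)) (trans (cong vertex eq) (vertex-index v))

  anyVertex? : ∀ {P : Vertex G → Set} → Decidable P → Dec (∃ P)
  anyVertex? {P} P? = map′
    (λ (i , p) → vertex i , p)
    (λ (v , p) → index v , subst P (sym (vertex-index v)) p)
    (any? (P? ∘ vertex))

  isBVertex? : ∀ {t} (c : Coloring G t) → Decidable (IsBVertex G c)
  isBVertex? c v = all? λ j →
    ¬? (j ≟ᶠ c v) →-dec anyVertex? λ w → adj? G v w ×-dec (c w ≟ᶠ j)

Colorable-mono : ∀ {G s t} → s ≤ t → Colorable G s → Colorable G t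
Colorable-mono s≤t (c , proper) =
  (λ v → inject≤ (c v) s≤t) ,
  λ uv eq → proper uv (inject≤-injective s≤t s≤t _ _ eq)

-- Removing one colour at a time; invariance under isomorphism

DownStep : Graph → Set
DownStep G = ∀ t → Colorable G t → BColorable G (suc t) → BColorable G t

downStep⇒bContinuous : ∀ {G} → DownStep G → BContinuous G
downStep⇒bContinuous {G} step χ χᵇ (colorable , _) (bcolorable , _) = descend χᵇ bcolorable
  where
  descend : ∀ s → BColorable G s → ∀ t → χ ≤ t → t ≤ s → BColorable G t
  descend s b t χ≤t t≤s with m≤n⇒m<n∨m≡n t≤s
  ... | inj₂ refl = b
  descend (suc s) b t χ≤t _ | inj₁ (s≤s t≤s) =
    descend s (step s (Colorable-mono {G} (≤-trans χ≤t t≤s) colorable) b) t χ≤t t≤s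

≅-sym : ∀ {G H} → G ≅ H → H ≅ G
≅-sym {G} {H} iso = record
  { vertices  = ↔-sym vertices
  ; adjacency = λ u v → mk⇔
      (λ uv → Equivalence.from (adjacency (from u) (from v))
                (subst₂ (Adj H) (sym (Inverse.inverseˡ vertices refl)) (sym (Inverse.inverseˡ vertices refl)) uv))
      (λ uv → subst₂ (Adj H) (Inverse.inverseˡ vertices refl) (Inverse.inverseˡ vertices refl)
                (Equivalence.to (adjacency (from u) (from v)) uv))
  }
  where open _≅_ iso

module _ {G H : Graph} (iso : G ≅ H) where
  open _≅_ iso

  private
    from∘to : ∀ v → from (to v) ≡ v
    from∘to v = Inverse.inverseʳ vertices refl

    from-adj : ∀ {u v} → Adj H u v → Adj G (from u) (from v)
    from-adj = Equivalence.to (_≅_.adjacency (≅-sym iso) _ _)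

    proper-≅ : ∀ {t} {c : Coloring G t} → IsProper G c → IsProper H (c ∘ from)
    proper-≅ proper uv = proper (from-adj uv)

  Colorable-≅ : ∀ {t} → Colorable G t → Colorable H t
  Colorable-≅ (c , proper) = c ∘ from , proper-≅ proper

  BColorable-≅ : ∀ {t} → BColorable G t → BColorable H t
  BColorable-≅ (c , proper , b) = c ∘ from , proper-≅ proper , λ i →
    let v , cv≡i , bv = b i in
    to v , trans (cong c (from∘to v)) cv≡i , λ j j≢ →
    let w , vw , cw≡j = bv j (λ eq → j≢ (trans eq (cong c (sym (from∘to v))))) in
    to w , Equivalence.to (adjacency v w) vw , trans (cong c (from∘to w)) cw≡j

DownStep-≅ : ∀ {G H} → G ≅ H → DownStep H → DownStep G
DownStep-≅ iso step t colorable bcolorable =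
  BColorable-≅ (≅-sym iso) (step t (Colorable-≅ iso colorable) (BColorable-≅ iso bcolorable))

-- Deleting a colour class

module _ (G : Graph) {n : ℕ} (c : Coloring G n) where

  IsBVertexWithout : Fin n → Vertex G → Set
  IsBVertexWithout k v = ∀ j → j ≢ c v → j ≢ k → ∃[ w ] Adj G v w × c w ≡ j

  missingColour : ∀ {v} → ¬ IsBVertex G c v → ∃[ j ] j ≢ c v × (∀ w → Adj G v w → c w ≢ j)
  missingColour {v} ¬b with ¬∀⟶∃¬ n _
    (λ j → ¬? (j ≟ᶠ c v) →-dec anyVertex? G λ w → adj? G v w ×-dec (c w ≟ᶠ j)) ¬b
  ... | j , ¬imp = j , (λ j≡cv → ¬imp λ j≢cv → contradiction j≡cv j≢cv) ,
                   λ w vw cw≡j → ¬imp λ _ → w , vw , cw≡j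

  -- A class is independent, so all of its vertices can move at once, each to
  -- a colour missing from its neighbourhood.
  evacuate : IsProper G c → ∀ k → (∀ v → c v ≡ k → ¬ IsBVertex G c v) →
             ∃ λ (d : Coloring G n) →
               IsProper G d × (∀ v → d v ≢ k) × (∀ v → c v ≢ k → d v ≡ c v)
  evacuate proper k ¬b = d , d-proper , d≢k , d≡c
    where
    new : ∀ v → Dec (c v ≡ k) → Fin n
    new v (yes cv≡k) = proj₁ (missingColour (¬b v cv≡k))
    new v (no _)     = c v

    d : Coloring G n
    d v = new v (c v ≟ᶠ k)

    d-proper : IsProper G d
    d-proper {u} {v} uv with c u ≟ᶠ k | c v ≟ᶠ k
    ... | yes cu | yes cv = contradiction (trans cu (sym cv)) (proper uv)
    ... | yes cu | no  _  = λ eq → proj₂ (proj₂ (missingColour (¬b u cu))) v uv (sym eq)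
    ... | no  _  | yes cv = λ eq → proj₂ (proj₂ (missingColour (¬b v cv))) u (symm G uv) eq
    ... | no  _  | no  _  = proper uv

    d≢k : ∀ v → d v ≢ k
    d≢k v with c v ≟ᶠ k
    ... | yes cv = λ eq → proj₁ (proj₂ (missingColour (¬b v cv))) (trans eq (sym cv))
    ... | no cv≢k = cv≢k

    d≡c : ∀ v → c v ≢ k → d v ≡ c v
    d≡c v cv≢k with c v ≟ᶠ k
    ... | yes cv = contradiction cv cv≢k
    ... | no _   = refl

-- Neighbours outside class `k` keep their colours, so `v` can lose sight of colour `k` only.
bVertex-evacuated : ∀ {G n} {c d : Coloring G n} {k v} →
  (∀ v → c v ≢ k → d v ≡ c v) → c v ≢ k → IsBVertex G c v → IsBVertexWithout G d k v
bVertex-evacuated d≡c cv≢k b j j≢dv j≢k with b j (λ eq → j≢dv (trans eq (sym (d≡c _ cv≢k))))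
... | w , vw , refl = w , vw , d≡c w j≢k

deleteColour : ∀ {G t} (d : Coloring G (suc t)) k → IsProper G d → (∀ v → d v ≢ k) →
  (∀ j → j ≢ k → ∃[ v ] d v ≡ j × IsBVertexWithout G d k v) → BColorable G t
deleteColour {G} {t} d k proper d≢k b = e , e-proper , λ i →
  let v , dv≡ , bv = b (punchIn k i) (punchInᵢ≢i k i) in
  v , punchIn-injective k _ _ (trans (punchIn-e v) dv≡) , λ j j≢ev →
  let w , vw , dw≡ = bv (punchIn k j)
                        (λ eq → j≢ev (punchIn-injective k _ _ (trans eq (sym (punchIn-e v)))))
                        (punchInᵢ≢i k j) in
  w , vw , punchIn-injective k _ _ (trans (punchIn-e w) dw≡)
  where
  e : Coloring G t
  e v = punchOut (≢-sym (d≢k v))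

  punchIn-e : ∀ v → punchIn k (e v) ≡ d v
  punchIn-e v = punchIn-punchOut (≢-sym (d≢k v))

  e-proper : IsProper G e
  e-proper {u} {v} uv eq =
    proper uv (trans (sym (punchIn-e u)) (trans (cong (punchIn k) eq) (punchIn-e v)))

-- Renaming colours

module _ {G : Graph} {n : ℕ} (π : Permutation′ n) {c : Coloring G n} where

  proper-permute : IsProper G c → IsProper G ((π ⟨$⟩ʳ_) ∘ c)
  proper-permute proper uv eq =
    proper uv (trans (sym (inverseˡ π)) (trans (cong (π ⟨$⟩ˡ_) eq) (inverseˡ π)))

  bVertex-permute : ∀ {v} → IsBVertex G c v → IsBVertex G ((π ⟨$⟩ʳ_) ∘ c) v
  bVertex-permute b j j≢ =
    let w , vw , cw≡ = b (π ⟨$⟩ˡ j) λ eq → j≢ (trans (sym (inverseʳ π)) (cong (π ⟨$⟩ʳ_) eq)) in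
    w , vw , trans (cong (π ⟨$⟩ʳ_) cw≡) (inverseʳ π)

  bVertex-unpermute : ∀ {v} → IsBVertex G ((π ⟨$⟩ʳ_) ∘ c) v → IsBVertex G c v
  bVertex-unpermute b j j≢ =
    let w , vw , eq = b (π ⟨$⟩ʳ j) λ eq → j≢ (trans (sym (inverseˡ π)) (trans (cong (π ⟨$⟩ˡ_) eq) (inverseˡ π))) in
    w , vw , trans (sym (inverseˡ π)) (trans (cong (π ⟨$⟩ˡ_) eq) (inverseˡ π))

transpose-first : ∀ {n} (i j : Fin n) → transpose i j ⟨$⟩ʳ i ≡ j
transpose-first i j rewrite dec-true (i ≟ᶠ i) refl = refl

transpose-other : ∀ {n} {i j k : Fin n} → k ≢ i → k ≢ j → transpose i j ⟨$⟩ʳ k ≡ k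
transpose-other {i = i} {j} {k} k≢i k≢j
  rewrite dec-false (k ≟ᶠ i) k≢i | dec-false (k ≟ᶠ j) k≢j = refl

-- Unions

Dominated : ∀ (G : Graph) {n} → Coloring G n → Fin n → Set
Dominated G c i = ∃[ v ] c v ≡ i × IsBVertex G c v

dominated? : ∀ (G : Graph) {n} (c : Coloring G n) → Decidable (Dominated G c)
dominated? G c i = anyVertex? G λ v → (c v ≟ᶠ i) ×-dec isBVertex? G c v

module _ {G H : Graph} where

  private
    infixr 6 _⊕_
    _⊕_ : ∀ {n} → Coloring G n → Coloring H n → Coloring (G ∪ H) n
    c ⊕ d = [ c , d ]′

    ⊕-proper : ∀ {n} {c : Coloring G n} {d : Coloring H n} →
               IsProper G c → IsProper H d → IsProper (G ∪ H) (c ⊕ d)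
    ⊕-proper p q (inj₁ uv) = p uv
    ⊕-proper p q (inj₂ uv) = q uv

    ⊕-bˡ : ∀ {n} {c : Coloring G n} {d : Coloring H n} {v} →
           IsBVertex G c v → IsBVertex (G ∪ H) (c ⊕ d) (inj₁ v)
    ⊕-bˡ b j j≢ = let w , vw , eq = b j j≢ in inj₁ w , inj₁ vw , eq

    ⊕-bʳ : ∀ {n} {c : Coloring G n} {d : Coloring H n} {v} →
           IsBVertex H d v → IsBVertex (G ∪ H) (c ⊕ d) (inj₂ v)
    ⊕-bʳ b j j≢ = let w , vw , eq = b j j≢ in inj₂ w , inj₂ vw , eq

    ⊕-wˡ : ∀ {n k} {c : Coloring G n} {d : Coloring H n} {v} →
           IsBVertexWithout G c k v → IsBVertexWithout (G ∪ H) (c ⊕ d) k (inj₁ v)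
    ⊕-wˡ b j j≢ j≢k = let w , vw , eq = b j j≢ j≢k in inj₁ w , inj₁ vw , eq

    ⊕-wʳ : ∀ {n k} {c : Coloring G n} {d : Coloring H n} {v} →
           IsBVertexWithout H d k v → IsBVertexWithout (G ∪ H) (c ⊕ d) k (inj₂ v)
    ⊕-wʳ b j j≢ j≢k = let w , vw , eq = b j j≢ j≢k in inj₂ w , inj₂ vw , eq

    dominated-⊎ : ∀ {n} {c : Coloring (G ∪ H) n} i → Dominated (G ∪ H) c i →
                  Dominated G (c ∘ inj₁) i ⊎ Dominated H (c ∘ inj₂) i
    dominated-⊎ i (inj₁ v , cv≡i , b) =
      inj₁ (v , cv≡i , λ j j≢ → case b j j≢ of λ { (inj₁ w , inj₁ vw , eq) → w , vw , eq })
    dominated-⊎ i (inj₂ v , cv≡i , b) =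
      inj₂ (v , cv≡i , λ j j≢ → case b j j≢ of λ { (inj₂ w , inj₂ vw , eq) → w , vw , eq })

  -- If neither part dominates every colour, say k₁ fails in G and k₂ in H, then
  -- after exchanging k₁ and k₂ in H both parts can evacuate k₁, and k₂ is
  -- still dominated by G.
  ∪-downStep : DownStep G → DownStep H → DownStep (G ∪ H)
  ∪-downStep stepG stepH t (c₀ , proper₀) (c , proper , b)
    with all? (dominated? G (c ∘ inj₁)) | all? (dominated? H (c ∘ inj₂))
  -- A part that dominates every colour is itself b-coloured; after its step the other part needs
  -- only a proper t-colouring, which `c₀` provides.
  ... | yes all₁ | _ =
    let d , d-proper , d-b = stepG t (c₀ ∘ inj₁ , proper₀ ∘ inj₁) (c ∘ inj₁ , proper ∘ inj₁ , all₁) in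
    d ⊕ (c₀ ∘ inj₂) , ⊕-proper {c = d} {c₀ ∘ inj₂} d-proper (proper₀ ∘ inj₂) , λ i →
    let v , dv≡i , bv = d-b i in inj₁ v , dv≡i , ⊕-bˡ bv
  ... | no _ | yes all₂ =
    let d , d-proper , d-b = stepH t (c₀ ∘ inj₂ , proper₀ ∘ inj₂) (c ∘ inj₂ , proper ∘ inj₂ , all₂) in
    (c₀ ∘ inj₁) ⊕ d , ⊕-proper {c = c₀ ∘ inj₁} {d} (proper₀ ∘ inj₁) d-proper , λ i →
    let v , dv≡i , bv = d-b i in inj₂ v , dv≡i , ⊕-bʳ bv
  ... | no ¬all₁ | no ¬all₂
    with k₁ , ¬k₁ ← ¬∀⟶∃¬ _ _ (dominated? G (c ∘ inj₁)) ¬all₁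
       | k₂ , ¬k₂ ← ¬∀⟶∃¬ _ _ (dominated? H (c ∘ inj₂)) ¬all₂ =
    deleteColour {G ∪ H} (d₁ ⊕ d₂) k₁
      (⊕-proper {c = d₁} {d₂} d₁-proper d₂-proper)
      (λ { (inj₁ v) → d₁≢k₁ v ; (inj₂ v) → d₂≢k₁ v })
      (λ j j≢k₁ → dominate j j≢k₁ (dominated-⊎ j (b j)))
    where
    π  = transpose k₂ k₁
    c₁ = c ∘ inj₁
    c₂ = (π ⟨$⟩ʳ_) ∘ c ∘ inj₂

    π≡k₁⇒≡k₂ : ∀ {i} → π ⟨$⟩ʳ i ≡ k₁ → i ≡ k₂
    π≡k₁⇒≡k₂ eq = Injection.injective (↔⇒↣ π) (trans eq (sym (transpose-first k₂ k₁)))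

    evac₁ = evacuate G c₁ (proper ∘ inj₁) k₁ λ v cv≡ bv → ¬k₁ (v , cv≡ , bv)
    d₁ = proj₁ evac₁
    d₁-proper = proj₁ (proj₂ evac₁)
    d₁≢k₁ = proj₁ (proj₂ (proj₂ evac₁))
    d₁≡c₁ = proj₂ (proj₂ (proj₂ evac₁))

    evac₂ = evacuate H c₂ (proper-permute {H} π {c ∘ inj₂} (proper ∘ inj₂)) k₁
      λ v cv≡ bv → ¬k₂ (v , π≡k₁⇒≡k₂ cv≡ , bVertex-unpermute {H} π {c ∘ inj₂} bv)
    d₂ = proj₁ evac₂
    d₂-proper = proj₁ (proj₂ evac₂)
    d₂≢k₁ = proj₁ (proj₂ (proj₂ evac₂))
    d₂≡c₂ = proj₂ (proj₂ (proj₂ evac₂))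

    dominate : ∀ j → j ≢ k₁ → Dominated G c₁ j ⊎ Dominated H (c ∘ inj₂) j →
               ∃[ v ] (d₁ ⊕ d₂) v ≡ j × IsBVertexWithout (G ∪ H) (d₁ ⊕ d₂) k₁ v
    dominate j j≢k₁ (inj₁ (v , refl , bv)) =
      inj₁ v , d₁≡c₁ v j≢k₁ , ⊕-wˡ (bVertex-evacuated {G} d₁≡c₁ j≢k₁ bv)
    dominate j j≢k₁ (inj₂ (v , refl , bv)) =
      inj₂ v , trans (d₂≡c₂ v c₂v≢k₁) c₂v≡j ,
      ⊕-wʳ (bVertex-evacuated {H} d₂≡c₂ c₂v≢k₁ (bVertex-permute {H} π {c ∘ inj₂} bv))
      where
      -- `j` is dominated in H and `k₂` is not, so `j` differs from both transposed colours.
      c₂v≡j : c₂ v ≡ c (inj₂ v)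
      c₂v≡j = transpose-other (λ { refl → ¬k₂ (v , refl , bv) }) j≢k₁

      c₂v≢k₁ : c₂ v ≢ k₁
      c₂v≢k₁ eq = j≢k₁ (trans (sym c₂v≡j) eq)

-- Joins

-- Each half is renumbered by an initial segment, so that the two parts of a join receive palettes
-- of their own whose sizes add up.
record Split {n : ℕ} (P : Fin n → Set) : Set where
  field
    #left #right : ℕ
    total        : #left + #right ≡ n
    left         : Fin #left → Fin n
    right        : Fin #right → Fin n
    left-inj     : ∀ {i j} → left i ≡ left j → i ≡ j
    right-inj    : ∀ {i j} → right i ≡ right j → i ≡ j
    left-P       : ∀ i → P (left i)
    right-¬P     : ∀ i → ¬ P (right i)
    left⁻¹       : ∀ j → P j → ∃[ i ] left i ≡ j
    right⁻¹      : ∀ j → ¬ P j → ∃[ i ] right i ≡ j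

split : ∀ {n} {P : Fin n → Set} → Decidable P → Split P
split {zero} P? = record
  { #left = 0 ; #right = 0 ; total = refl ; left = id ; right = id
  ; left-inj = id ; right-inj = id ; left-P = λ () ; right-¬P = λ ()
  ; left⁻¹ = λ () ; right⁻¹ = λ () }
split {suc n} {P} P? with split (P? ∘ suc) | P? zero
... | S | yes p = record
  { #left = suc #left ; #right = #right ; total = cong suc total
  ; left = λ { zero → zero ; (suc i) → suc (left i) } ; right = suc ∘ right
  ; left-inj = λ { {zero} {zero} _ → refl
                 ; {suc i} {suc j} eq → cong suc (left-inj (suc-injective eq)) }
  ; right-inj = right-inj ∘ suc-injective
  ; left-P = λ { zero → p ; (suc i) → left-P i } ; right-¬P = right-¬P
  ; left⁻¹ = λ { zero _ → zero , refl
               ; (suc j) pj → let i , eq = left⁻¹ j pj in suc i , cong suc eq }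
  ; right⁻¹ = λ { zero ¬p → contradiction p ¬p
                ; (suc j) ¬pj → let i , eq = right⁻¹ j ¬pj in i , cong suc eq } }
  where open Split S
... | S | no ¬p = record
  { #left = #left ; #right = suc #right ; total = trans (+-suc #left #right) (cong suc total)
  ; left = suc ∘ left ; right = λ { zero → zero ; (suc i) → suc (right i) }
  ; left-inj = left-inj ∘ suc-injective
  ; right-inj = λ { {zero} {zero} _ → refl
                  ; {suc i} {suc j} eq → cong suc (right-inj (suc-injective eq)) }
  ; left-P = left-P ; right-¬P = λ { zero → ¬p ; (suc i) → right-¬P i }
  ; left⁻¹ = λ { zero p → contradiction p ¬p
               ; (suc j) pj → let i , eq = left⁻¹ j pj in i , cong suc eq }
  ; right⁻¹ = λ { zero _ → zero , refl
                ; (suc j) ¬pj → let i , eq = right⁻¹ j ¬pj in suc i , cong suc eq } }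
  where open Split S

module _ {G H : Graph} where

  module _ {n : ℕ} (c : Coloring (G ∨ H) n) (proper : IsProper (G ∨ H) c) where

    private
      -- Colours that occur in neither part fall into the right half, so every colour is counted.
      S : Split λ j → ∃[ u ] c (inj₁ u) ≡ j
      S = split λ j → anyVertex? G λ u → c (inj₁ u) ≟ᶠ j

      open Split S

      unused : ∀ w → ¬ (∃[ u ] c (inj₁ u) ≡ c (inj₂ w))
      unused w (u , eq) = proper {inj₁ u} {inj₂ w} tt eq

      cˡ : Coloring G #left
      cˡ u = proj₁ (left⁻¹ (c (inj₁ u)) (u , refl))

      left-cˡ : ∀ u → left (cˡ u) ≡ c (inj₁ u)
      left-cˡ u = proj₂ (left⁻¹ (c (inj₁ u)) (u , refl))

      cʳ : Coloring H #right
      cʳ w = proj₁ (right⁻¹ (c (inj₂ w)) (unused w))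

      right-cʳ : ∀ w → right (cʳ w) ≡ c (inj₂ w)
      right-cʳ w = proj₂ (right⁻¹ (c (inj₂ w)) (unused w))

      cˡ-proper : IsProper G cˡ
      cˡ-proper {u} {v} uv eq =
        proper {inj₁ u} {inj₁ v} uv (trans (sym (left-cˡ u)) (trans (cong left eq) (left-cˡ v)))

      cʳ-proper : IsProper H cʳ
      cʳ-proper {u} {v} uv eq =
        proper {inj₂ u} {inj₂ v} uv (trans (sym (right-cʳ u)) (trans (cong right eq) (right-cʳ v)))

    ∨-split : ∃₂ λ a b → a + b ≡ n × Colorable G a × Colorable H b
    ∨-split = #left , #right , total , (cˡ , cˡ-proper) , (cʳ , cʳ-proper)

    -- The parts share no colour, so a neighbour that shows a colour of one half lies in the part
    -- owning that half.
    ∨-split-b : (∀ i → Dominated (G ∨ H) c i) →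
                ∃₂ λ a b → a + b ≡ n × BColorable G a × BColorable H b
    ∨-split-b b = #left , #right , total , (cˡ , cˡ-proper , bˡ) , (cʳ , cʳ-proper , bʳ)
      where
      bˡ : ∀ i → Dominated G cˡ i
      bˡ i with b (left i)
      ... | inj₂ w , eq , _ = contradiction (subst (λ j → ∃[ u ] c (inj₁ u) ≡ j) (sym eq) (left-P i)) (unused w)
      ... | inj₁ v , eq , bv = v , left-inj (trans (left-cˡ v) eq) , λ j j≢ →
        case bv (left j) (λ eq′ → j≢ (left-inj (trans eq′ (sym (left-cˡ v))))) of λ
          { (inj₁ w , vw , eq′) → w , vw , left-inj (trans (left-cˡ w) eq′)
          ; (inj₂ w , _ , eq′) →
              contradiction (subst (λ j → ∃[ u ] c (inj₁ u) ≡ j) (sym eq′) (left-P j)) (unused w) }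

      bʳ : ∀ i → Dominated H cʳ i
      bʳ i with b (right i)
      ... | inj₁ u , eq , _ = contradiction (u , eq) (right-¬P i)
      ... | inj₂ v , eq , bv = v , right-inj (trans (right-cʳ v) eq) , λ j j≢ →
        case bv (right j) (λ eq′ → j≢ (right-inj (trans eq′ (sym (right-cʳ v))))) of λ
          { (inj₂ w , vw , eq′) → w , vw , right-inj (trans (right-cʳ w) eq′)
          ; (inj₁ u , _ , eq′) → contradiction (u , eq′) (right-¬P j) }

  -- A b-vertex of one part sees the whole other part, where every colour of the other palette
  -- occurs because it is dominated there.
  ∨-bColorable : ∀ {a b} → BColorable G a → BColorable H b → BColorable (G ∨ H) (a + b)
  ∨-bColorable {a} {b} (c , c-proper , c-b) (d , d-proper , d-b) = e , (λ {u} {v} → proper {u} {v}) , dominated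
    where
    e : Coloring (G ∨ H) (a + b)
    e (inj₁ v) = c v ↑ˡ b
    e (inj₂ v) = a ↑ʳ d v

    ↑ˡ≢↑ʳ : ∀ {i j} → i ↑ˡ b ≢ a ↑ʳ j
    ↑ˡ≢↑ʳ {i} {j} eq with trans (sym (splitAt-↑ˡ a i b)) (trans (cong (splitAt a) eq) (splitAt-↑ʳ a b j))
    ... | ()

    proper : IsProper (G ∨ H) e
    proper {inj₁ u} {inj₁ v} uv eq = c-proper uv (↑ˡ-injective b _ _ eq)
    proper {inj₁ u} {inj₂ v} uv eq = ↑ˡ≢↑ʳ eq
    proper {inj₂ u} {inj₁ v} uv eq = ↑ˡ≢↑ʳ (sym eq)
    proper {inj₂ u} {inj₂ v} uv eq = d-proper uv (↑ʳ-injective a _ _ eq)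

    split⁻¹ : ∀ j → (∃[ i ] i ↑ˡ b ≡ j) ⊎ (∃[ i ] a ↑ʳ i ≡ j)
    split⁻¹ j with splitAt a j in eq
    ... | inj₁ i = inj₁ (i , splitAt⁻¹-↑ˡ eq)
    ... | inj₂ i = inj₂ (i , splitAt⁻¹-↑ʳ eq)

    dominated : ∀ j → Dominated (G ∨ H) e j
    dominated j with split⁻¹ j
    ... | inj₁ (i , refl) = let v , cv≡i , bv = c-b i in inj₁ v , cong (_↑ˡ b) cv≡i , λ j′ j′≢ →
      case split⁻¹ j′ of λ
        { (inj₁ (i′ , refl)) → let w , vw , eq = bv i′ (j′≢ ∘ cong (_↑ˡ b)) in
                               inj₁ w , vw , cong (_↑ˡ b) eq
        ; (inj₂ (i′ , refl)) → let w , eq , _ = d-b i′ in inj₂ w , tt , cong (a ↑ʳ_) eq }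
    ... | inj₂ (i , refl) = let v , dv≡i , bv = d-b i in inj₂ v , cong (a ↑ʳ_) dv≡i , λ j′ j′≢ →
      case split⁻¹ j′ of λ
        { (inj₂ (i′ , refl)) → let w , vw , eq = bv i′ (j′≢ ∘ cong (a ↑ʳ_)) in
                               inj₂ w , vw , cong (a ↑ʳ_) eq
        ; (inj₁ (i′ , refl)) → let w , eq , _ = c-b i′ in inj₁ w , tt , cong (_↑ˡ b) eq }

  -- A proper colouring splits t as `a₀ + b₀` and the b-colouring splits t + 1 as `a + b`, so
  -- `a₀ < a` or `b₀ < b`. The part with the strict inequality is colourable with one colour fewer,
  -- and its own step applies.
  ∨-downStep : DownStep G → DownStep H → DownStep (G ∨ H)
  ∨-downStep stepG stepH t (c₀ , proper₀) (c , proper , dominated)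
    with ∨-split c₀ proper₀ | ∨-split-b c proper dominated
  ... | a₀ , b₀ , refl , ca₀ , cb₀ | a , b , eq , ba , bb with a₀ <? a
  ∨-downStep stepG stepH t _ _
      | a₀ , b₀ , refl , ca₀ , cb₀ | suc a , b , eq , ba , bb | yes (s≤s a₀≤a) =
    subst (BColorable (G ∨ H)) (cong pred eq)
      (∨-bColorable (stepG a (Colorable-mono {G} a₀≤a ca₀) ba) bb)
  ... | no a₀≮a with b₀ <? b
  ∨-downStep stepG stepH t _ _
      | a₀ , b₀ , refl , ca₀ , cb₀ | a , suc b , eq , ba , bb | no _ | yes (s≤s b₀≤b) =
    subst (BColorable (G ∨ H)) (cong pred (trans (sym (+-suc a b)) eq))
      (∨-bColorable ba (stepH b (Colorable-mono {H} b₀≤b cb₀) bb))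
  ... | no b₀≮b = contradiction (subst (_≤ a₀ + b₀) eq (+-mono-≤ (≮⇒≥ a₀≮a) (≮⇒≥ b₀≮b))) 1+n≰n

-- Unique lists and function update

lookup-injective : ∀ {A : Set} {xs : List A} → Unique xs →
                   ∀ {i j} → lookup xs i ≡ lookup xs j → i ≡ j
lookup-injective (x∉ ∷ u) {zero}  {zero}  eq = refl
lookup-injective (x∉ ∷ u) {zero}  {suc j} eq = contradiction eq (All.lookup x∉ (∈-lookup j))
lookup-injective (x∉ ∷ u) {suc i} {zero}  eq = contradiction (sym eq) (All.lookup x∉ (∈-lookup i))
lookup-injective (x∉ ∷ u) {suc i} {suc j} eq = cong suc (lookup-injective u eq)

unique-length≤ : ∀ {A : Set} {n} {f : A → Fin n} → (∀ {x y} → f x ≡ f y → x ≡ y) →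
                 ∀ {xs} → Unique xs → length xs ≤ n
unique-length≤ f-inj u = injective⇒≤ (lookup-injective u ∘ f-inj)

∉⇒All≢ : ∀ {A : Set} {x : A} {xs} → ¬ x ∈ xs → All (x ≢_) xs
∉⇒All≢ x∉ = All.tabulate λ y∈ x≡y → x∉ (subst (_∈ _) (sym x≡y) y∈)

module _ {V A : Set} (_≟_ : DecidableEquality V) where

  update : (V → A) → V → A → V → A
  update f x a y with y ≟ x
  ... | yes _ = a
  ... | no  _ = f y

  update-same : ∀ {f x a} → update f x a x ≡ a
  update-same {x = x} with x ≟ x
  ... | yes _  = refl
  ... | no x≢x = contradiction refl x≢x

  update-other : ∀ {f x a y} → y ≢ x → update f x a y ≡ f y
  update-other {x = x} {y = y} y≢x with y ≟ x
  ... | yes y≡x = contradiction y≡x y≢x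
  ... | no  _   = refl

-- Co-bipartite graphs

-- In the complement T, which is bipartite, the colour classes are the edges of
-- a matching together with the unmatched ("lone") vertices.  A vertex not
-- T-adjacent to a lone vertex ("clean") dominates, and here every class has
-- one.  We search for an alternating path from a lone vertex on the true side,
-- passing through clean vertices only until a T-neighbour of another lone
-- vertex is met; shifting colours along that path frees a colour.  If the
-- search fails, König's argument yields a clique of G with suc t vertices.
module CoBipartite
  (G : Graph) (side : Vertex G → Bool)
  (coBipartite : ∀ {u v} → side u ≡ side v → u ≢ v → Adj G u v)
  {t : ℕ} (c : Coloring G (suc t)) (proper : IsProper G c)
  (dominated : ∀ i → Dominated G c i)
  where

  private
    V : Set
    V = Vertex G

    _≟_ : DecidableEquality V
    _≟_ = Graph._≟_ G

    open import Data.List.Membership.DecPropositional _≟_ using (_∈?_)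

    side-dec : ∀ v → side v ≡ true ⊎ side v ≡ false
    side-dec v with side v
    ... | true  = inj₁ refl
    ... | false = inj₂ refl

    sides-clash : ∀ {A : Set} {u v} → side u ≡ true → side v ≡ false → u ≡ v → A
    sides-clash su sv refl with trans (sym su) sv
    ... | ()

    third-side : ∀ {u v w} → side u ≢ side w → side v ≢ side w → side u ≡ side v
    third-side {u} {v} {w} u≢w v≢w with side u | side v | side w
    ... | true  | true  | _     = refl
    ... | false | false | _     = refl
    ... | true  | false | true  = contradiction refl u≢w
    ... | true  | false | false = contradiction refl v≢w
    ... | false | true  | true  = contradiction refl v≢w
    ... | false | true  | false = contradiction refl u≢w

    -- Each side is a clique of G, so a class has at most one vertex on each side.
    unique-on-side : ∀ {d : Coloring G (suc t)} → IsProper G d →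
                     ∀ {u v} → side u ≡ side v → d u ≡ d v → u ≡ v
    unique-on-side p {u} {v} s eq with u ≟ v
    ... | yes u≡v = u≡v
    ... | no u≢v = contradiction eq (p (coBipartite s u≢v))

    Lone : V → Set
    Lone z = ∀ w → c w ≡ c z → w ≡ z

    Partner : V → V → Set
    Partner z w = w ≢ z × c w ≡ c z

    lone⊎partner : ∀ z → Lone z ⊎ ∃ (Partner z)
    lone⊎partner z with anyVertex? G (λ w → ¬? (w ≟ z) ×-dec (c w ≟ᶠ c z))
    ... | yes p = inj₂ p
    ... | no ¬p = inj₁ λ w eq → decidable-stable (w ≟ z) λ w≢z → ¬p (w , w≢z , eq)

    lone? : Decidable Lone
    lone? z with lone⊎partner z
    ... | inj₁ l = yes l
    ... | inj₂ (w , w≢z , eq) = no λ l → w≢z (l w eq)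

    -- Measured against `c` throughout the search: a class of a later colouring is a pair, a lone
    -- vertex of `c`, or the current endpoint, so cleanness survives every shift.
    Clean : V → Set
    Clean v = ∀ z → Lone z → z ≢ v → Adj G v z

    DirtiedBy : V → V → Set
    DirtiedBy v z = Lone z × z ≢ v × ¬ Adj G v z

    clean⊎dirty : ∀ v → Clean v ⊎ ∃ (DirtiedBy v)
    clean⊎dirty v with anyVertex? G (λ z → lone? z ×-dec ¬? (z ≟ v) ×-dec ¬? (adj? G v z))
    ... | yes p = inj₂ p
    ... | no ¬p = inj₁ λ z l z≢v → decidable-stable (adj? G v z) λ ¬vz → ¬p (z , l , z≢v , ¬vz)

    bVertex-clean : ∀ {v} → IsBVertex G c v → Clean v
    bVertex-clean {v} b z l z≢v with b (c z) (λ eq → z≢v (sym (l v (sym eq))))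
    ... | w , vw , eq = subst (Adj G v) (l w eq) vw

    -- The b-vertex of a singleton class can only be its one vertex.
    lone-clean : ∀ {z} → Lone z → Clean z
    lone-clean {z} l with dominated (c z)
    ... | v , eq , b = subst Clean (l v eq) (bVertex-clean b)

    -- The colouring after shifting colours along an alternating path from a
    -- lone vertex to e: only partners of vertices in R have been recoloured,
    -- and e has become a singleton class.
    record State (R : List V) (e : V) : Set where
      field
        d        : Coloring G (suc t)
        d-proper : IsProper G d
        e-side   : side e ≡ true
        fixed    : ∀ {v} → side v ≡ true → d v ≡ c v
        changed  : ∀ {v} → side v ≡ false →
                   d v ≡ c v ⊎ ∃[ x ] x ∈ R × side x ≡ true × c x ≡ c v
        e-alone  : ∀ {w} → side w ≡ false → d w ≢ c e
        paired   : ∀ w → w ≢ e → Lone w ⊎ ∃[ w′ ] w′ ≢ w × d w′ ≡ d w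
        covered  : ∀ j → j ≢ c e → ∃[ v ] Clean v × d v ≡ j

    weaken : ∀ {R e x} → State R e → State (x ∷ R) e
    weaken s = record
      { State s
      ; changed = λ sv → Sum.map₂ (λ (y , y∈R , p) → y , there y∈R , p) (State.changed s sv)
      }

    start : ∀ {R x} → side x ≡ true → Lone x → State R x
    start {x = x} sx l = record
      { d        = c
      ; d-proper = proper
      ; e-side   = sx
      ; fixed    = λ _ → refl
      ; changed  = λ _ → inj₁ refl
      ; e-alone  = λ {w} sw eq → sides-clash sx sw (sym (l w eq))
      ; paired   = λ w _ → lone⊎partner w
      ; covered  = λ j _ → let v , eq , b = dominated j in v , bVertex-clean b , eq
      }

    module Recolour {R e} (s : State R e) (o : V) (¬eo : ¬ Adj G e o) where
      open State s public

      d′ : Coloring G (suc t)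
      d′ = update _≟_ d o (c e)

      d′o : d′ o ≡ c e
      d′o = update-same _≟_ {f = d}

      d′-other : ∀ {v} → v ≢ o → d′ v ≡ d v
      d′-other = update-other _≟_

      de : d e ≡ c e
      de = fixed e-side

      -- On the false side the colour of `e` is absent by `e-alone`; on the true side only `e` has
      -- it, and `e` is not adjacent to `o`.
      e-free : ∀ {v} → Adj G o v → d v ≢ c e
      e-free {v} ov eq with side-dec v
      ... | inj₂ sv = e-alone sv eq
      ... | inj₁ sv = ¬eo (subst (λ x → Adj G x o)
              (unique-on-side proper (trans sv (sym e-side)) (trans (sym (fixed sv)) eq)) (symm G ov))

      d′-proper : IsProper G d′
      d′-proper {u} {v} uv eq with u ≟ o | v ≟ o
      ... | yes refl | yes refl = irrefl G refl uv
      ... | yes refl | no  _    = e-free uv (sym eq)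
      ... | no  _    | yes refl = e-free (symm G uv) eq
      ... | no  _    | no  _    = d-proper uv eq

    -- `o` leaves the class it shares with `x` for that of `e`. Now `x` is alone, and the clean
    -- vertex `e` covers the class it shares with `o`.
    step : ∀ {R e o x} → State R e → Clean e → side o ≡ false → ¬ Adj G e o →
           side x ≡ true → c x ≡ c o → ¬ x ∈ R → e ≢ x → State (x ∷ R) x
    step {R} {e} {o} {x} s e-clean so ¬eo sx cx≡co x∉R e≢x = record
      { d        = d′
      ; d-proper = d′-proper
      ; e-side   = sx
      ; fixed    = λ sv → trans (d′-other λ v≡o → sides-clash sv so v≡o) (fixed sv)
      ; changed  = changed′
      ; e-alone  = e-alone′
      ; paired   = paired′
      ; covered  = covered′
      }
      where
      open Recolour s o ¬eo

      e≢o : e ≢ o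
      e≢o = sides-clash e-side so

      -- Had `o` been recoloured before, its partner would be in `R`; that partner is `x`, which is
      -- new.
      do≡cx : d o ≡ c x
      do≡cx with changed so
      ... | inj₁ eq = trans eq (sym cx≡co)
      ... | inj₂ (y , y∈R , sy , eq) = contradiction
        (subst (_∈ R) (unique-on-side proper (trans sy (sym sx)) (trans eq (sym cx≡co))) y∈R) x∉R

      changed′ : ∀ {v} → side v ≡ false →
                 d′ v ≡ c v ⊎ ∃[ y ] y ∈ x ∷ R × side y ≡ true × c y ≡ c v
      changed′ {v} sv with v ≟ o
      ... | yes refl = inj₂ (x , here refl , sx , cx≡co)
      ... | no _ = Sum.map₂ (λ (y , y∈R , p) → y , there y∈R , p) (changed sv)

      e-alone′ : ∀ {w} → side w ≡ false → d′ w ≢ c x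
      e-alone′ {w} sw eq with w ≟ o
      ... | yes refl = e≢x (unique-on-side proper (trans e-side (sym sx)) eq)
      ... | no w≢o = w≢o (unique-on-side d-proper (trans sw (sym so)) (trans eq (sym do≡cx)))

      paired′ : ∀ w → w ≢ x → Lone w ⊎ ∃[ w′ ] w′ ≢ w × d′ w′ ≡ d′ w
      paired′ w w≢x with w ≟ o | w ≟ e
      ... | yes refl | _        = inj₂ (e , e≢o , trans (d′-other e≢o) de)
      ... | no _     | yes refl = inj₂ (o , ≢-sym e≢o , trans d′o (sym de))
      ... | no w≢o   | no w≢e with paired w w≢e
      ... | inj₁ l = inj₁ l
      ... | inj₂ (w′ , w′≢w , eq) with w′ ≟ o
      ... | no w′≢o = inj₂ (w′ , w′≢w , trans (d′-other w′≢o) eq)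
      ... | yes refl with side-dec w
      ... | inj₁ sw = contradiction
        (unique-on-side proper (trans sw (sym sx)) (trans (sym (fixed sw)) (trans (sym eq) do≡cx))) w≢x
      ... | inj₂ sw = contradiction (unique-on-side d-proper (trans so (sym sw)) eq) w′≢w

      covered′ : ∀ j → j ≢ c x → ∃[ v ] Clean v × d′ v ≡ j
      covered′ j j≢cx with j ≟ᶠ c e
      ... | yes refl = e , e-clean , trans (d′-other e≢o) de
      ... | no j≢ce with covered j j≢ce
      ... | v , v-clean , dv≡j =
        v , v-clean , trans (d′-other λ { refl → j≢cx (trans (sym dv≡j) do≡cx) }) dv≡j

    -- Giving `z` the colour of `e` empties the class of `z`. The endpoint `e` is dirty, but the
    -- lone vertex `z` is clean and covers the merged class.
    augment : ∀ {R e z} → State R e → DirtiedBy e z → BColorable G t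
    augment {R} {e} {z} s (z-lone , z≢e , ¬ez) =
      deleteColour {G} d′ (c z) d′-proper avoids λ j j≢cz →
        let v , v-clean , d′v≡j = covered′ j j≢cz in v , d′v≡j , clean-b v-clean
      where
      open Recolour s z ¬ez

      sz : side z ≡ false
      sz with side-dec z
      ... | inj₂ sz = sz
      ... | inj₁ sz = contradiction (coBipartite (trans e-side (sym sz)) (≢-sym z≢e)) ¬ez

      dz≡cz : d z ≡ c z
      dz≡cz with changed sz
      ... | inj₁ eq = eq
      ... | inj₂ (y , _ , sy , eq) = sides-clash sy sz (z-lone y eq)

      z-alone : ∀ {w} → d w ≡ c z → w ≡ z
      z-alone {w} eq with side-dec w
      ... | inj₁ sw = z-lone w (trans (sym (fixed sw)) eq)
      ... | inj₂ sw = unique-on-side d-proper (trans sw (sym sz)) (trans eq (sym dz≡cz))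

      avoids : ∀ v → d′ v ≢ c z
      avoids v eq with v ≟ z
      ... | yes _ = z≢e (sym (z-lone e eq))
      ... | no v≢z = v≢z (z-alone eq)

      paired′ : ∀ w → Lone w ⊎ ∃[ w′ ] w′ ≢ w × d′ w′ ≡ d′ w
      paired′ w with w ≟ z | w ≟ e
      ... | yes refl | _        = inj₂ (e , ≢-sym z≢e , trans (d′-other (≢-sym z≢e)) de)
      ... | no _     | yes refl = inj₂ (z , z≢e , trans d′o (sym de))
      ... | no w≢z   | no w≢e with paired w w≢e
      ... | inj₁ l = inj₁ l
      ... | inj₂ (w′ , w′≢w , eq) =
        inj₂ (w′ , w′≢w , trans (d′-other λ { refl → w≢z (z-alone (trans (sym eq) dz≡cz)) }) eq)

      covered′ : ∀ j → j ≢ c z → ∃[ v ] Clean v × d′ v ≡ j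
      covered′ j j≢cz with j ≟ᶠ c e
      ... | yes refl = z , lone-clean z-lone , d′o
      ... | no j≢ce with covered j j≢ce
      ... | v , v-clean , dv≡j =
        v , v-clean , trans (d′-other λ { refl → j≢cz (trans (sym dv≡j) dz≡cz) }) dv≡j

      -- A class with two vertices meets both sides, hence contains a vertex on the side of `v`,
      -- adjacent to `v`. Any other class is a lone vertex of `c`, which a clean `v` sees.
      clean-b : ∀ {v} → Clean v → IsBVertexWithout G d′ (c z) v
      clean-b {v} v-clean i i≢d′v i≢cz with covered′ i i≢cz
      ... | w , _ , refl with adj? G v w
      ... | yes vw = w , vw , refl
      ... | no ¬vw with paired′ w
      ... | inj₁ l = contradiction (v-clean w l (λ { refl → i≢d′v refl })) ¬vw
      ... | inj₂ (w′ , w′≢w , eq) =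
        w′ ,
        coBipartite
          (third-side {w = w}
            (λ sv≡sw → ¬vw (coBipartite sv≡sw (λ { refl → i≢d′v refl })))
            (λ sw′≡sw → w′≢w (unique-on-side d′-proper sw′≡sw eq)))
          (λ { refl → i≢d′v (sym eq) }) ,
        eq

    Candidate : List V → V → Set
    Candidate R x = ¬ x ∈ R × side x ≡ true ×
      (Lone x ⊎ ∃[ e ] e ∈ R × ∃[ o ] side o ≡ false × ¬ Adj G e o × c x ≡ c o)

    candidate? : ∀ R → Decidable (Candidate R)
    candidate? R x = ¬? (x ∈? R) ×-dec (side x ≟ᵇ true) ×-dec
      (lone? x ⊎-dec anyVertex? G λ e → (e ∈? R) ×-dec anyVertex? G λ o →
        (side o ≟ᵇ false) ×-dec ¬? (adj? G e o) ×-dec (c x ≟ᶠ c o))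

    -- Every reached vertex keeps a colouring of its own, since the search may branch at any of
    -- them.
    Reached : List V → Set
    Reached R = ∀ {e} → e ∈ R → Clean e × State R e

    reach : ∀ {R x} → Reached R → Candidate R x → State (x ∷ R) x
    reach reached (x∉R , sx , inj₁ l) = start sx l
    reach reached (x∉R , sx , inj₂ (e , e∈R , o , so , ¬eo , cx≡co)) =
      let e-clean , s = reached e∈R in
      step s e-clean so ¬eo sx cx≡co x∉R λ { refl → x∉R e∈R }

    module Closed {R} (reached : Reached R) (closed : ∀ x → ¬ Candidate R x) where

      -- König's independent set of T: reached vertices on the true side, and vertices on the false
      -- side not matched to a reached one.
      IsRepresentative : V → Set
      IsRepresentative v = (side v ≡ true × v ∈ R) ⊎ (side v ≡ false × (∀ x → x ∈ R → c x ≢ c v))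

      representative : ∀ j → ∃[ v ] c v ≡ j × IsRepresentative v
      representative j with anyVertex? G (λ x → (x ∈? R) ×-dec (c x ≟ᶠ j))
                          | anyVertex? G (λ v → (side v ≟ᵇ false) ×-dec (c v ≟ᶠ j))
      ... | yes (x , x∈R , eq) | _ = x , eq , inj₁ (State.e-side (proj₂ (reached x∈R)) , x∈R)
      ... | no ¬R | yes (v , sv , refl) = v , refl , inj₂ (sv , λ x x∈R eq → ¬R (x , x∈R , eq))
      -- A class that avoids both `R` and the false side is a lone vertex on the true side, hence
      -- would still be a candidate.
      ... | no ¬R | no ¬false with dominated j
      ... | v , refl , _ = contradiction (v∉R , on-true v refl , inj₁ v-lone) (closed v)
        where
        v∉R : ¬ v ∈ R
        v∉R v∈R = ¬R (v , v∈R , refl)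

        on-true : ∀ w → c w ≡ c v → side w ≡ true
        on-true w eq with side-dec w
        ... | inj₁ sw = sw
        ... | inj₂ sw = contradiction (w , sw , eq) ¬false

        v-lone : Lone v
        v-lone w eq = unique-on-side proper (trans (on-true w eq) (sym (on-true v refl))) eq

      -- Otherwise `y` is a T-neighbour of the reached `x`. A partner of `y` would be a candidate,
      -- so `y` is lone, against the cleanness of `x`.
      mixed-adjacent : ∀ {x y} → side x ≡ true → x ∈ R → side y ≡ false →
                       (∀ x → x ∈ R → c x ≢ c y) → Adj G x y
      mixed-adjacent {x} {y} sx x∈R sy none = decidable-stable (adj? G x y) λ ¬xy →
        ¬xy (proj₁ (reached x∈R) y (y-lone ¬xy) (λ y≡x → sides-clash sx sy (sym y≡x)))
        where
        y-lone : ¬ Adj G x y → Lone y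
        y-lone ¬xy w eq with side-dec w
        ... | inj₂ sw = unique-on-side proper (trans sw (sym sy)) eq
        ... | inj₁ sw = contradiction
          ((λ w∈R → none w w∈R eq) , sw , inj₂ (x , x∈R , y , sy , ¬xy , eq)) (closed w)

      representatives-adjacent : ∀ {u v} → IsRepresentative u → IsRepresentative v →
                                 c u ≢ c v → Adj G u v
      representatives-adjacent (inj₁ (su , _)) (inj₁ (sv , _)) ≢ =
        coBipartite (trans su (sym sv)) (≢ ∘ cong c)
      representatives-adjacent (inj₂ (su , _)) (inj₂ (sv , _)) ≢ =
        coBipartite (trans su (sym sv)) (≢ ∘ cong c)
      representatives-adjacent (inj₁ (su , u∈R)) (inj₂ (sv , none)) _ = mixed-adjacent su u∈R sv none
      representatives-adjacent (inj₂ (su , none)) (inj₁ (sv , v∈R)) _ =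
        symm G (mixed-adjacent sv v∈R su none)

      ¬colorable : ¬ Colorable G t
      ¬colorable (c₀ , proper₀) = 1+n≰n (injective⇒≤ {f = c₀ ∘ proj₁ ∘ representative} inj)
        where
        inj : ∀ {i j} → c₀ (proj₁ (representative i)) ≡ c₀ (proj₁ (representative j)) → i ≡ j
        inj {i} {j} eq with representative i | representative j
        ... | u , refl , ru | v , refl , rv = decidable-stable (c u ≟ᶠ c v) λ cu≢cv →
          proper₀ (representatives-adjacent ru rv cu≢cv) eq

    -- Each round adds a new vertex to the duplicate-free list `R`, so `R` would outgrow G if the
    -- fuel ran out.
    search : Colorable G t → ∀ fuel R → order G ≤ fuel + length R → Unique R → Reached R →
             BColorable G t
    search colorable fuel R bound R! reached with anyVertex? G (candidate? R)
    ... | no none = contradiction colorable (Closed.¬colorable reached λ x cand → none (x , cand))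
    ... | yes (x , cand) with reach reached cand | clean⊎dirty x
    ... | s | inj₂ (z , dirty) = augment s dirty
    ... | s | inj₁ x-clean = continue fuel bound
      where
      x∷R! : Unique (x ∷ R)
      x∷R! = ∉⇒All≢ (proj₁ cand) ∷ R!

      reached′ : Reached (x ∷ R)
      reached′ (here refl)  = x-clean , s
      reached′ (there e∈R) = let e-clean , s = reached e∈R in e-clean , weaken s

      continue : ∀ fuel → order G ≤ fuel + length R → BColorable G t
      continue zero bound =
        contradiction (≤-trans (unique-length≤ (index-injective G) x∷R!) bound) 1+n≰n
      continue (suc fuel) bound =
        search colorable fuel (x ∷ R) (subst (order G ≤_) (sym (+-suc fuel (length R))) bound) x∷R! reached′

  bColorable : Colorable G t → BColorable G t
  bColorable colorable = search colorable (order G) [] (m≤m+n (order G) 0) [] λ ()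

coBipartite-downStep : ∀ {G} (side : Vertex G → Bool) →
  (∀ {u v} → side u ≡ side v → u ≢ v → Adj G u v) → DownStep G
coBipartite-downStep {G} side coBipartite t colorable (c , proper , dominated) =
  CoBipartite.bColorable G side coBipartite c proper dominated colorable

-- Elimination orders of forests

∈-length≤ : ∀ {A : Set} {n} {f : Fin n → A} {xs} → (∀ {i j} → f i ≡ f j → i ≡ j) →
            (∀ i → f i ∈ xs) → n ≤ length xs
∈-length≤ {A} f-inj f∈ = injective⇒≤ λ eq → f-inj (index-injective′ (f∈ _) (f∈ _) eq)
  where index-injective′ = Setoidₘ.index-injective (setoid A)

module _ {A : Set} {R : A → A → Set} where

  -- Used with an edge from `w` back to the vertex before `y`: it closes a cycle, and the bound
  -- `1 ≤` makes that cycle long enough.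
  linked-cut : ∀ {y ys w} → w ∈ ys → Linked R (y ∷ ys) →
               ∃[ n ] 1 ≤ length (take n ys) × (∀ {z} → R w z → Linked R (y ∷ (take n ys ∷ʳ z)))
  linked-cut (here refl) (yw ∷ _) = 1 , s≤s z≤n , λ wz → yw ∷ wz ∷ [-]
  linked-cut (there w∈) (yz ∷ l) =
    let n , _ , close = linked-cut w∈ l in suc n , s≤s z≤n , λ wz → yz ∷ close wz

module _ (G : Graph) where

  private
    V : Set
    V = Vertex G

    _≟_ : DecidableEquality V
    _≟_ = Graph._≟_ G

    open import Data.List.Membership.DecPropositional _≟_ using (_∈?_)

  vertices : List V
  vertices = tabulate (vertex G)

  ∈-vertices : ∀ v → v ∈ vertices
  ∈-vertices v = subst (_∈ vertices) (vertex-index G v) (∈-tabulate⁺ (index G v))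

  vertices! : Unique vertices
  vertices! = tabulate⁺ λ {i} {j} eq →
    trans (sym (index-vertex G i)) (trans (cong (index G) eq) (index-vertex G j))

  -- Leaf removal read backwards. The first vertex is prescribed so that a forest can be rooted at a
  -- vertex of large degree.
  record EliminationOrder (S : List V) (r : V) : Set where
    field
      rank          : V → ℕ
      bound         : ℕ
      bounded       : ∀ {v} → v ∈ S → rank v < bound
      injective     : ∀ {u v} → u ∈ S → v ∈ S → rank u ≡ rank v → u ≡ v
      first         : ∀ {v} → v ∈ S → rank r ≤ rank v
      unique-parent : ∀ {v p q} → v ∈ S → p ∈ S → q ∈ S → Adj G p v → Adj G q v →
                      rank p < rank v → rank q < rank v → p ≡ q

  IsLeafIn : List V → V → Set
  IsLeafIn S v = v ∈ S × (∀ {p q} → p ∈ S → q ∈ S → Adj G v p → Adj G v q → p ≡ q)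

  module _ (acyclic : ¬ HasCycle G) where

    module _ (S : List V) (r : V) where

      private
        Isolated : Set
        Isolated = ∀ {w} → w ∈ S → ¬ Adj G r w

      -- The head of a path is extended until it is a leaf; r never becomes the
      -- head, being either already on the path or isolated.
      extendToLeaf : ∀ fuel x y ys → order G ≤ fuel + length (x ∷ y ∷ ys) →
        Unique (x ∷ y ∷ ys) → Linked (Adj G) (x ∷ y ∷ ys) → x ∈ S → x ≢ r →
        r ∈ y ∷ ys ⊎ Isolated → ∃[ v ] v ≢ r × IsLeafIn S v
      extendToLeaf fuel x y ys bound xs! xs-linked x∈S x≢r r-safe
        with anyVertex? G (λ w → (w ∈? S) ×-dec adj? G x w ×-dec ¬? (w ≟ y))
      ... | no none = x , x≢r , x∈S , λ p∈S q∈S xp xq → trans (is-y p∈S xp) (sym (is-y q∈S xq))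
        where
        is-y : ∀ {w} → w ∈ S → Adj G x w → w ≡ y
        is-y {w} w∈S xw = decidable-stable (w ≟ y) λ w≢y → none (w , w∈S , xw , w≢y)
      ... | yes (w , w∈S , xw , w≢y) with w ∈? ys
      ... | yes w∈ys =
        let n , 1≤ , close = linked-cut w∈ys (Linked.tail xs-linked) in
        contradiction
          (x , y ∷ take n ys , s≤s 1≤ , take⁺ (2 + n) xs! ,
           Linked.head xs-linked ∷ close (symm G xw))
          acyclic
      ... | no w∉ys = continue fuel bound
        where
        w∉ : ¬ w ∈ x ∷ y ∷ ys
        w∉ (here refl)          = irrefl G refl xw
        w∉ (there (here w≡y))   = w≢y w≡y
        w∉ (there (there w∈ys)) = w∉ys w∈ys

        w! : Unique (w ∷ x ∷ y ∷ ys)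
        w! = ∉⇒All≢ w∉ ∷ xs!

        w≢r : w ≢ r
        w≢r refl = [ w∉ ∘ there , (λ isolated → isolated x∈S (symm G xw)) ]′ r-safe

        continue : ∀ fuel → order G ≤ fuel + length (x ∷ y ∷ ys) → ∃[ v ] v ≢ r × IsLeafIn S v
        continue zero bound =
          contradiction (≤-trans (unique-length≤ (index-injective G) w!) bound) 1+n≰n
        continue (suc fuel) bound =
          extendToLeaf fuel w x (y ∷ ys) (subst (order G ≤_) (sym (+-suc fuel _)) bound) w!
            (symm G xw ∷ xs-linked) w∈S w≢r (Sum.map₁ there r-safe)

      -- The path starts at a neighbour of `r`, with `r` behind it, if there is one; otherwise `r`
      -- is isolated in `S` and any other vertex may start.
      leaf : ∀ {s} → s ∈ S → s ≢ r → r ∈ S → ∃[ v ] v ≢ r × IsLeafIn S v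
      leaf {s} s∈S s≢r r∈S with anyVertex? G (λ w → (w ∈? S) ×-dec adj? G r w)
      ... | yes (w , w∈S , rw) =
        extendToLeaf (order G) w r [] (m≤m+n _ _) ((w≢r ∷ []) ∷ [] ∷ []) (symm G rw ∷ [-]) w∈S w≢r
          (inj₁ (here refl))
        where
        w≢r : w ≢ r
        w≢r refl = irrefl G refl rw
      ... | no isolated with anyVertex? G (λ w → (w ∈? S) ×-dec adj? G s w)
      ... | no none = s , s≢r , s∈S , λ {p} p∈S _ sp _ → contradiction (p , p∈S , sp) none
      ... | yes (w , w∈S , sw) =
        extendToLeaf (order G) w s [] (m≤m+n _ _) (((λ { refl → irrefl G refl sw }) ∷ []) ∷ [] ∷ [])
          (symm G sw ∷ [-]) w∈S (λ { refl → isolated (s , s∈S , symm G sw) })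
          (inj₂ λ {v} v∈S rv → isolated (v , v∈S , rv))

    -- A leaf other than `r` is ranked last: its at most one neighbour in `S` is its only possible
    -- parent, and it is a parent of nobody.
    eliminationOrder : ∀ n {S r} → length S ≤ n → r ∈ S → EliminationOrder S r
    eliminationOrder n {S} {r} len r∈S with anyVertex? G (λ s → (s ∈? S) ×-dec ¬? (s ≟ r))
    ... | no only-r = record
      { rank          = λ _ → 0
      ; bound         = 1
      ; bounded       = λ _ → s≤s z≤n
      ; injective     = λ u∈S v∈S _ → trans (is-r u∈S) (sym (is-r v∈S))
      ; first         = λ _ → z≤n
      ; unique-parent = λ _ _ _ _ _ ()
      }
      where
      is-r : ∀ {v} → v ∈ S → v ≡ r
      is-r {v} v∈S = decidable-stable (v ≟ r) λ v≢r → only-r (v , v∈S , v≢r)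
    eliminationOrder zero {[]} len () | yes _
    eliminationOrder (suc n) {S} {r} len r∈S | yes (s , s∈S , s≢r)
      with x , x≢r , x∈S , x-leaf ← leaf S r s∈S s≢r r∈S = record
      { rank          = rank
      ; bound         = suc E.bound
      ; bounded       = bounded
      ; injective     = injective
      ; first         = first
      ; unique-parent = unique-parent
      }
      where
      S′ : List V
      S′ = filter (λ v → ¬? (v ≟ x)) S

      in-S′ : ∀ {v} → v ∈ S → v ≢ x → v ∈ S′
      in-S′ = ∈-filter⁺ (λ v → ¬? (v ≟ x))

      shorter : length S′ < length S
      shorter = filter-notAll (λ v → ¬? (v ≟ x)) S (Any.map (λ x≡v v≢x → v≢x (sym x≡v)) x∈S)

      module E = EliminationOrder
        (eliminationOrder n {S′} {r} (s≤s⁻¹ (≤-trans shorter len)) (in-S′ r∈S (≢-sym x≢r)))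

      rank : V → ℕ
      rank = update _≟_ E.rank x E.bound

      bounded : ∀ {v} → v ∈ S → rank v < suc E.bound
      bounded {v} v∈S with v ≟ x
      ... | yes _  = ≤-refl
      ... | no v≢x = m≤n⇒m≤1+n (E.bounded (in-S′ v∈S v≢x))

      injective : ∀ {u v} → u ∈ S → v ∈ S → rank u ≡ rank v → u ≡ v
      injective {u} {v} u∈S v∈S eq with u ≟ x | v ≟ x
      ... | yes refl | yes refl = refl
      ... | yes refl | no v≢x   = contradiction (sym eq) (<⇒≢ (E.bounded (in-S′ v∈S v≢x)))
      ... | no u≢x   | yes refl = contradiction eq (<⇒≢ (E.bounded (in-S′ u∈S u≢x)))
      ... | no u≢x   | no v≢x   = E.injective (in-S′ u∈S u≢x) (in-S′ v∈S v≢x) eq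

      first : ∀ {v} → v ∈ S → rank r ≤ rank v
      first {v} v∈S with r ≟ x | v ≟ x
      ... | yes refl | _      = contradiction refl x≢r
      ... | no _     | yes _  = <⇒≤ (E.bounded (in-S′ r∈S (≢-sym x≢r)))
      ... | no _     | no v≢x = E.first (in-S′ v∈S v≢x)

      unique-parent : ∀ {v p q} → v ∈ S → p ∈ S → q ∈ S → Adj G p v → Adj G q v →
                      rank p < rank v → rank q < rank v → p ≡ q
      unique-parent {v} {p} {q} v∈S p∈S q∈S pv qv p<v q<v with v ≟ x | p ≟ x | q ≟ x
      ... | yes refl | _      | _      = x-leaf p∈S q∈S (symm G pv) (symm G qv)
      ... | no v≢x   | yes _  | _      = contradiction p<v (<-asym (E.bounded (in-S′ v∈S v≢x)))
      ... | no v≢x   | no _   | yes _  = contradiction q<v (<-asym (E.bounded (in-S′ v∈S v≢x)))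
      ... | no v≢x   | no p≢x | no q≢x =
        E.unique-parent (in-S′ v∈S v≢x) (in-S′ p∈S p≢x) (in-S′ q∈S q≢x) pv qv p<v q<v

  module Rooted {r : V} (E : EliminationOrder vertices r) where

    open EliminationOrder E public using (rank; bound)

    bounded : ∀ v → rank v < bound
    bounded v = EliminationOrder.bounded E (∈-vertices v)

    rank-injective : ∀ {u v} → rank u ≡ rank v → u ≡ v
    rank-injective = EliminationOrder.injective E (∈-vertices _) (∈-vertices _)

    first : ∀ v → rank r ≤ rank v
    first v = EliminationOrder.first E (∈-vertices v)

    IsChild : V → V → Set
    IsChild p v = Adj G p v × rank p < rank v

    isChild? : ∀ p v → Dec (IsChild p v)
    isChild? p v = adj? G p v ×-dec (rank p <? rank v)

    unique-parent : ∀ {v p q} → IsChild p v → IsChild q v → p ≡ q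
    unique-parent (pv , p<v) (qv , q<v) =
      EliminationOrder.unique-parent E (∈-vertices _) (∈-vertices _) (∈-vertices _) pv qv p<v q<v

    adj⇒child : ∀ {u v} → Adj G u v → IsChild u v ⊎ IsChild v u
    adj⇒child {u} {v} uv with <-cmp (rank u) (rank v)
    ... | tri< u<v _ _ = inj₁ (uv , u<v)
    ... | tri> _ _ v<u = inj₂ (symm G uv , v<u)
    ... | tri≈ _ u≡v _ = contradiction uv (irrefl G (rank-injective u≡v))

    not-self-child : ∀ {v} → ¬ IsChild v v
    not-self-child (vv , _) = irrefl G refl vv

    -- Sides are fixed in order of rank. The only constraint on a vertex by then is to differ from
    -- its unique parent.
    bipartite : ∀ k → ∃ λ (side : V → Bool) →
                ∀ {p v} → rank v < k → IsChild p v → side p ≢ side v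
    bipartite zero = (λ _ → true) , λ ()
    bipartite (suc k) with bipartite k | anyVertex? G (λ v → rank v ≟ⁿ k)
    ... | side , ok | no none = side , λ v<1+k → ok (≤∧≢⇒< (s≤s⁻¹ v<1+k) λ eq → none (_ , eq))
    ... | side , ok | yes (x , refl) with anyVertex? G (λ q → isChild? q x)
    ... | no orphan = side , λ {p} v<1+k pv →
      ok (≤∧≢⇒< (s≤s⁻¹ v<1+k) λ eq → orphan (p , subst (IsChild p) (rank-injective eq) pv)) pv
    ... | yes (q , qx) = update _≟_ side x (not (side q)) , ok′
      where
      ok′ : ∀ {p v} → rank v < suc (rank x) → IsChild p v →
            update _≟_ side x (not (side q)) p ≢ update _≟_ side x (not (side q)) v
      ok′ {p} {v} v<1+x pv with p ≟ x | v ≟ x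
      ... | yes refl | _        = contradiction (≤-trans (proj₂ pv) (s≤s⁻¹ v<1+x)) 1+n≰n
      ... | no _     | yes refl = λ eq → not-¬ refl (trans (cong side (unique-parent qx pv)) eq)
      ... | no _     | no v≢x   = ok (≤∧≢⇒< (s≤s⁻¹ v<1+x) (v≢x ∘ rank-injective)) pv

    minimal : ∀ {P : V → Set} → Decidable P → ∀ {v} → P v →
              ∃[ m ] P m × (∀ {u} → rank u < rank m → ¬ P u)
    minimal {P} P? {v} pv = go (suc (rank v)) ≤-refl pv
      where
      go : ∀ n {v} → rank v < n → P v → ∃[ m ] P m × (∀ {u} → rank u < rank m → ¬ P u)
      go (suc n) {v} v<1+n pv with anyVertex? G (λ u → (rank u <? rank v) ×-dec P? u)
      ... | no none = v , pv , λ {u} u<v pu → none (u , u<v , pu)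
      ... | yes (u , u<v , pu) = go n (≤-trans u<v (s≤s⁻¹ v<1+n)) pu

-- Co-trees

coTree-downStep : ∀ {G} → IsCoTree G → DownStep G
coTree-downStep {G} ((r , _) , acyclic) = coBipartite-downStep {G} side λ {u} {v} su≡sv u≢v →
  decidable-stable (adj? G u v) λ ¬uv →
    case adj⇒child (u≢v , ¬uv) of λ
      { (inj₁ uv) → proj₂ (bipartite bound) (bounded v) uv su≡sv
      ; (inj₂ vu) → proj₂ (bipartite bound) (bounded u) vu (sym su≡sv) }
  where
  open Rooted (complement G) (eliminationOrder (complement G) acyclic _ ≤-refl (∈-vertices (complement G) r))

  side : Vertex G → Bool
  side = proj₁ (bipartite bound)

-- b-colourings of forests

module _ {V C : Set} (_≟_ : DecidableEquality V) {Ok : V → C → Set}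
         (Ok? : ∀ v j → Dec (Ok v j)) (h₀ : V → C) where

  -- The clause for `ρ` is conditional because below the root `ρ` is the parent's own colour and
  -- must not be used.
  record Assignment (ρ : C) (js : List C) (us : List V) : Set where
    field
      h       : V → C
      legal   : ∀ u → h u ≡ h₀ u ⊎ (u ∈ us × Ok u (h u))
      covers  : ∀ {j} → j ∈ js → ∃[ u ] u ∈ us × h u ≡ j
      covers′ : (∀ {u} → u ∈ us → Ok u ρ) → ∃[ u ] u ∈ us × h u ≡ ρ

  private
    assignOne : ∀ {ρ j js us us′ a} → a ∈ us′ → Ok a j → (∀ {u} → u ∈ us → u ∈ us′) →
                (∀ {u} → u ∈ us → a ≢ u) → Assignment ρ js us → Assignment ρ (j ∷ js) us′
    assignOne {ρ} {j} {js} {us} {us′} {a} a∈ ok us⊆us′ a∉us A = record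
      { h       = h′
      ; legal   = legal′
      ; covers  = λ { (here refl) → a , a∈ , update-same _≟_ {f = h} ; (there j∈) → lift (covers j∈) }
      ; covers′ = λ ok → lift (covers′ (ok ∘ us⊆us′))
      }
      where
      open Assignment A

      h′ : V → C
      h′ = update _≟_ h a j

      legal′ : ∀ u → h′ u ≡ h₀ u ⊎ (u ∈ us′ × Ok u (h′ u))
      legal′ u with u ≟ a
      ... | yes refl = inj₂ (a∈ , ok)
      ... | no _     = Sum.map₂ (λ (u∈ , ok) → us⊆us′ u∈ , ok) (legal u)

      lift : ∀ {i} → ∃[ u ] u ∈ us × h u ≡ i → ∃[ u ] u ∈ us′ × h′ u ≡ i
      lift (u , u∈ , eq) = u , us⊆us′ u∈ , trans (update-other _≟_ (≢-sym (a∉us u∈))) eq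

  -- Since there are more vertices than colours, each colour in turn has two
  -- vertices to choose from, and a last vertex is left over for ρ.
  assign : ∀ ρ js us → Unique us → length js < length us →
    (∀ {j} → j ∈ js → ∀ {u v} → u ∈ us → v ∈ us → u ≢ v → Ok u j ⊎ Ok v j) →
    Assignment ρ js us
  assign ρ [] (a ∷ us) _ _ _ with Ok? a ρ
  ... | yes ok = record
    { h       = update _≟_ h₀ a ρ
    ; legal   = legal
    ; covers  = λ ()
    ; covers′ = λ _ → a , here refl , update-same _≟_ {f = h₀}
    }
    where
    legal : ∀ u → update _≟_ h₀ a ρ u ≡ h₀ u ⊎ (u ∈ a ∷ us × Ok u (update _≟_ h₀ a ρ u))
    legal u with u ≟ a
    ... | yes refl = inj₂ (here refl , ok)
    ... | no _     = inj₁ refl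
  ... | no ¬ok = record
    { h       = h₀
    ; legal   = λ _ → inj₁ refl
    ; covers  = λ ()
    ; covers′ = λ ok → contradiction (ok (here refl)) ¬ok
    }
  assign ρ (j ∷ js) (a ∷ []) _ (s≤s ()) _
  assign ρ (j ∷ js) (a ∷ b ∷ us) ((a≢b ∷ a∉us) ∷ b∉us ∷ us!) (s≤s len) choice
    with choice (here refl) (here refl) (there (here refl)) a≢b
  ... | inj₁ ok = assignOne (here refl) ok there (All.lookup (a≢b ∷ a∉us))
    (assign ρ js (b ∷ us) (b∉us ∷ us!) len
      λ j∈ u∈ v∈ → choice (there j∈) (there u∈) (there v∈))
  ... | inj₂ ok = assignOne (there (here refl)) ok skip
    (λ { (here refl) → ≢-sym a≢b ; (there u∈) → All.lookup b∉us u∈ })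
    (assign ρ js (a ∷ us) (a∉us ∷ us!) len λ j∈ u∈ v∈ → choice (there j∈) (skip u∈) (skip v∈))
    where
    skip : ∀ {u} → u ∈ a ∷ us → u ∈ a ∷ b ∷ us
    skip (here eq)  = here eq
    skip (there u∈) = there (there u∈)

⊆-length≤ : ∀ {A : Set} {xs ys : List A} → Unique xs → (∀ {x} → x ∈ xs → x ∈ ys) →
            length xs ≤ length ys
⊆-length≤ xs! xs⊆ys = ∈-length≤ (lookup-injective xs!) (xs⊆ys ∘ ∈-lookup)

-- The b-vertices x i are chosen as the first suc s vertices of degree > s in
-- the order of rank.  A non-selected vertex below which every colour is blocked
-- would itself have large degree and precede a selected vertex.  Colours are
-- propagated from the root, all children of a vertex at once; room to cover all
-- colours around a selected p comes from the root r being itself selected: if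
-- p ≢ r then the colour of r is blocked nowhere below p, and r has no parent.
module ForestColouring
  (G : Graph) {r : Vertex G} (E : EliminationOrder G (vertices G) r)
  {s : ℕ} (colorable : Colorable G (suc s))
  where

  private
    V : Set
    V = Vertex G

    _≟_ : DecidableEquality V
    _≟_ = Graph._≟_ G

    Colour : Set
    Colour = Fin (suc s)

    open Rooted G E

  neighbours : V → List V
  neighbours v = filter (adj? G v) (vertices G)

  Dense : V → Set
  Dense v = suc s ≤ length (neighbours v)

  dense : ∀ {v} (f : Colour → V) → (∀ {i j} → f i ≡ f j → i ≡ j) → (∀ i → Adj G v (f i)) → Dense v
  dense {v} f f-inj vf = ∈-length≤ f-inj λ i → ∈-filter⁺ (adj? G v) (∈-vertices G (f i)) (vf i)

  record Selection (m : ℕ) : Set where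
    field
      x      : Fin m → V
      x-inj  : ∀ {i j} → x i ≡ x j → i ≡ j
      x-dense : ∀ i → Dense (x i)
      x-down : ∀ {u i} → Dense u → rank u < rank (x i) → ∃[ j ] x j ≡ u

  select : ∀ {n} {g : Fin n → V} → (∀ {i j} → g i ≡ g j → i ≡ j) → (∀ i → Dense (g i)) →
           ∀ m → m ≤ n → Selection m
  select g-inj g-dense zero m≤n = record
    { x = λ () ; x-inj = λ { {()} } ; x-dense = λ () ; x-down = λ { {i = ()} } }
  select {n} {g} g-inj g-dense (suc m) m<n with select {g = g} g-inj g-dense m (<⇒≤ m<n)
  ... | S with all? (λ i → any? λ j → Selection.x S j ≟ g i)
  -- Otherwise the `n` vertices `g i` would inject into the `m < n` already selected.
  ... | yes hit = contradiction (≤-trans m<n (injective⇒≤ {f = proj₁ ∘ hit} λ {i} {j} eq →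
          g-inj (trans (sym (proj₂ (hit i))) (trans (cong (Selection.x S) eq) (proj₂ (hit j)))))) 1+n≰n
  ... | no ¬hit with i , fresh ← ¬∀⟶∃¬ n _ (λ i → any? λ j → Selection.x S j ≟ g i) ¬hit
      with minimal {P = λ u → Dense u × ¬ (∃[ j ] Selection.x S j ≡ u)}
             (λ u → (suc s ≤? length (neighbours u)) ×-dec ¬? (any? λ j → Selection.x S j ≟ u))
             (g-dense i , fresh)
  ... | v , (v-dense , v-fresh) , v-min = record
    { x = λ { zero → v ; (suc j) → x j }
    ; x-inj = λ { {zero} {zero} _ → refl
                ; {zero} {suc j} eq → contradiction (j , sym eq) v-fresh
                ; {suc i} {zero} eq → contradiction (i , eq) v-fresh
                ; {suc i} {suc j} eq → cong suc (x-inj eq) }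
    ; x-dense = λ { zero → v-dense ; (suc j) → x-dense j }
    ; x-down = λ { {u} {zero} u-dense u<v → let j , eq = decidable-stable (any? λ j → x j ≟ u)
                                                  λ u-fresh → v-min u<v (u-dense , u-fresh)
                                            in suc j , eq
                 ; {u} {suc j} u-dense u<x → let k , eq = x-down u-dense u<x in suc k , eq }
    }
    where open Selection S

  module _ (r-dense : Dense r) (S : Selection (suc s)) where

    open Selection S

    selected? : ∀ v → Dec (∃[ i ] x i ≡ v)
    selected? v = any? λ i → x i ≟ v

    r-selected : ∃[ ρ ] x ρ ≡ r
    r-selected with x zero ≟ r
    ... | yes eq = zero , eq
    ... | no ≢r = x-down r-dense (≤∧≢⇒< (first (x zero)) (≢r ∘ sym ∘ rank-injective))

    ρ : Colour
    ρ = proj₁ r-selected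

    not-child-r : ∀ {p} → ¬ IsChild p (x ρ)
    not-child-r (_ , p<r) =
      contradiction (≤-trans p<r (subst (λ v → rank v ≤ _) (sym (proj₂ r-selected)) (first _))) 1+n≰n

    -- Selected vertices have prescribed colours, so a parent of `x k` must avoid `k` in advance.
    Valid : V → Colour → Set
    Valid v k = (∀ {i} → x i ≡ v → k ≡ i) × ¬ IsChild v (x k)

    valid? : ∀ v k → Dec (Valid v k)
    valid? v k = map′ (λ f → λ {i} → f i) (λ f i → f {i}) (all? λ i → (x i ≟ v) →-dec (k ≟ᶠ i))
                 ×-dec ¬? (isChild? v (x k))

    valid-selected : ∀ i → Valid (x i) i
    valid-selected i = (λ eq → sym (x-inj eq)) , not-self-child

    initial : ∀ v → ∃ (Valid v)
    initial v with selected? v | any? (λ j → ¬? (isChild? v (x j)))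
    ... | yes (i , refl) | _ = i , valid-selected i
    ... | no unselected | yes (j , free) = j , (λ eq → contradiction (_ , eq) unselected) , free
    ... | no unselected | no blocked = contradiction (x-down v-dense (proj₂ (below zero))) unselected
      where
      below : ∀ j → IsChild v (x j)
      below j = decidable-stable (isChild? v (x j)) λ free → blocked (j , free)

      v-dense : Dense v
      v-dense = dense x x-inj (proj₁ ∘ below)

    -- If every colour other than `k` is blocked below `u`, the parent `p` stands in for `x k` as
    -- the last of `suc s` neighbours, so `u` is dense and would be selected before such a child. If
    -- `k` is the only colour, the edge `pu` contradicts `colorable`.
    validChild : ∀ {p u k} → IsChild p u → Valid p k → ∃[ j ] j ≢ k × Valid u j
    validChild {p} {u} {k} pu (_ , k-free)
      with selected? u | any? (λ j → ¬? (j ≟ᶠ k) ×-dec ¬? (isChild? u (x j)))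
    ... | yes (i , refl) | _ = i , (λ { refl → k-free pu }) , valid-selected i
    ... | no unselected | yes (j , j≢k , free) = j , j≢k , (λ eq → contradiction (_ , eq) unselected) , free
    ... | no unselected | no blocked = contradiction one-colour (proj₂ colorable (proj₁ pu))
      where
      below : ∀ {j} → j ≢ k → IsChild u (x j)
      below {j} j≢k = decidable-stable (isChild? u (x j)) λ free → blocked (j , j≢k , free)

      f : Colour → V
      f j with j ≟ᶠ k
      ... | yes _ = p
      ... | no _  = x j

      not-p : ∀ {j} → j ≢ k → x j ≢ p
      not-p j≢k refl = <-asym (proj₂ (below j≢k)) (proj₂ pu)

      f-inj : ∀ {i j} → f i ≡ f j → i ≡ j
      f-inj {i} {j} eq with i ≟ᶠ k | j ≟ᶠ k
      ... | yes refl | yes refl = refl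
      ... | yes refl | no j≢k   = contradiction (sym eq) (not-p j≢k)
      ... | no i≢k   | yes refl = contradiction eq (not-p i≢k)
      ... | no _     | no _     = x-inj eq

      uf : ∀ j → Adj G u (f j)
      uf j with j ≟ᶠ k
      ... | yes _  = symm G (proj₁ pu)
      ... | no j≢k = proj₁ (below j≢k)

      u-dense : Dense u
      u-dense = dense f f-inj uf

      all-k : ∀ j → j ≡ k
      all-k j = decidable-stable (j ≟ᶠ k) λ j≢k → unselected (x-down u-dense (proj₂ (below j≢k)))

      one-colour : proj₁ colorable p ≡ proj₁ colorable u
      one-colour = trans (all-k _) (sym (all-k _))

    Extends : V → Colour → (V → Colour) → Set
    Extends p k h = (∀ {u} → IsChild p u → h u ≢ k × Valid u (h u)) ×
                    (∀ {i} → x i ≡ p → ∀ j → j ≢ k → ∃[ u ] IsChild p u × h u ≡ j)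

    module _ {p k} (k-valid : Valid p k) where

      private
        default : ∀ u → Dec (IsChild p u) → Colour
        default u (yes pu) = proj₁ (validChild pu k-valid)
        default u (no _)   = k

        h₀ : V → Colour
        h₀ u = default u (isChild? p u)

        h₀-valid : ∀ {u} → IsChild p u → h₀ u ≢ k × Valid u (h₀ u)
        h₀-valid {u} pu with isChild? p u
        ... | yes pu = proj₂ (validChild pu k-valid)
        ... | no ¬pu = contradiction pu ¬pu

      extendUnselected : ¬ (∃[ i ] x i ≡ p) → ∃ (Extends p k)
      extendUnselected unselected = h₀ , h₀-valid , λ eq → contradiction (_ , eq) unselected

      module _ (xk≡p : x k ≡ p) where

        private
          Free : V → Set
          Free u = IsChild p u × ¬ (∃[ i ] x i ≡ u)

          free? : ∀ u → Dec (Free u)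
          free? u = isChild? p u ×-dec ¬? (selected? u)

          -- A selected child `x j` shows `j` by itself; the remaining colours fall to the
          -- unselected children, with `ρ` left for the end.
          Needed : Colour → Set
          Needed j = j ≢ k × j ≢ ρ × ¬ IsChild p (x j)

          needed? : ∀ j → Dec (Needed j)
          needed? j = ¬? (j ≟ᶠ k) ×-dec ¬? (j ≟ᶠ ρ) ×-dec ¬? (isChild? p (x j))

          taken? : ∀ j → Dec (IsChild p (x j))
          taken? j = isChild? p (x j)

          us : List V
          us = filter free? (vertices G)

          js ks : List Colour
          js = filter needed? (allFin (suc s))
          ks = filter taken? (allFin (suc s))

          us! : Unique us
          us! = filter⁺ free? (vertices! G)

          us-free : ∀ {u} → u ∈ us → Free u
          us-free u∈ = proj₂ (∈-filter⁻ free? {xs = vertices G} u∈)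

          js-needed : ∀ {j} → j ∈ js → Needed j
          js-needed j∈ = proj₂ (∈-filter⁻ needed? {xs = allFin (suc s)} j∈)

          ks-taken : ∀ {j} → j ∈ ks → IsChild p (x j)
          ks-taken j∈ = proj₂ (∈-filter⁻ taken? {xs = allFin (suc s)} j∈)

          ks++js! : Unique (ks ++ js)
          ks++js! = ++⁺ (filter⁺ taken? (allFin⁺ (suc s))) (filter⁺ needed? (allFin⁺ (suc s)))
            λ (j∈ks , j∈js) → proj₂ (proj₂ (js-needed j∈js)) (ks-taken j∈ks)

          k∉ : ¬ k ∈ ks ++ js
          k∉ k∈ with ∈-++⁻ ks k∈
          ... | inj₁ k∈ks = proj₂ k-valid (ks-taken k∈ks)
          ... | inj₂ k∈js = proj₁ (js-needed k∈js) refl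

          ρ∉ : ¬ ρ ∈ ks ++ js
          ρ∉ ρ∈ with ∈-++⁻ ks ρ∈
          ... | inj₁ ρ∈ks = not-child-r (ks-taken ρ∈ks)
          ... | inj₂ ρ∈js = proj₁ (proj₂ (js-needed ρ∈js)) refl

          colours≤ : ∀ {is} → Unique is → length is ≤ suc s
          colours≤ = unique-length≤ id

          p-dense : Dense p
          p-dense = subst Dense xk≡p (x-dense k)

          neighbours≤ : ∀ qs → (∀ {q} → IsChild q p → q ∈ qs) → suc s ≤ length (qs ++ map x ks ++ us)
          neighbours≤ qs parent∈ = ≤-trans p-dense (⊆-length≤ (filter⁺ (adj? G p) (vertices! G)) λ v∈ →
            classify (proj₂ (∈-filter⁻ (adj? G p) {xs = vertices G} v∈)))
            where
            classify : ∀ {v} → Adj G p v → v ∈ qs ++ map x ks ++ us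
            classify {v} pv with adj⇒child pv | selected? v
            ... | inj₂ vp | _ = ∈-++⁺ˡ (parent∈ vp)
            ... | inj₁ pv | yes (i , refl) =
              ∈-++⁺ʳ qs (∈-++⁺ˡ (∈-map⁺ x (∈-filter⁺ taken? (∈-allFin i) pv)))
            ... | inj₁ pv | no unselected =
              ∈-++⁺ʳ qs (∈-++⁺ʳ (map x ks) (∈-filter⁺ free? (∈-vertices G v) (pv , unselected)))

          children-length : length (map x ks ++ us) ≡ length ks + length us
          children-length = trans (length-++ (map x ks)) (cong (_+ length us) (length-map x ks))

          -- `ks`, `js`, `k` and `ρ` together use at most `suc s` colours, while the parent, the
          -- selected children and `us` make up at least `suc s` neighbours. Away from the root the
          -- two colours `k` and `ρ` outweigh the one parent; at the root they coincide, but there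
          -- is no parent.
          js<us : length js < length us
          js<us = +-cancelˡ-< (length ks) _ _
            (subst₂ _<_ (length-++ ks) children-length enough)
            where
            enough : length (ks ++ js) < length (map x ks ++ us)
            enough with k ≟ᶠ ρ
            ... | yes refl = ≤-trans (colours≤ (∉⇒All≢ k∉ ∷ ks++js!))
              (neighbours≤ [] λ {q} qp → contradiction (subst (IsChild q) (sym xk≡p) qp) not-child-r)
            ... | no k≢ρ with colours≤ (((k≢ρ ∷ ∉⇒All≢ k∉)) ∷ ∉⇒All≢ ρ∉ ∷ ks++js!)
            ...   | colours with anyVertex? G (λ q → isChild? q p)
            ... | no orphan = <⇒≤ (≤-trans colours (neighbours≤ [] λ qp → contradiction (_ , qp) orphan))
            ... | yes (q , qp) =
              s≤s⁻¹ (≤-trans colours (neighbours≤ (q ∷ []) λ q′p → here (unique-parent q′p qp)))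

          Ok : V → Colour → Set
          Ok u j = j ≢ k × Valid u j

          ok? : ∀ u j → Dec (Ok u j)
          ok? u j = ¬? (j ≟ᶠ k) ×-dec valid? u j

          ok-free : ∀ {u j} → u ∈ us → j ≢ k → ¬ IsChild u (x j) → Ok u j
          ok-free u∈ j≢k free = j≢k , (λ eq → contradiction (_ , eq) (proj₂ (us-free u∈))) , free

          -- `x j` has at most one parent, so it blocks `j` at no more than one of two vertices.
          choice : ∀ {j} → j ∈ js → ∀ {u v} → u ∈ us → v ∈ us → u ≢ v → Ok u j ⊎ Ok v j
          choice {j} j∈ {u} {v} u∈ v∈ u≢v with isChild? u (x j)
          ... | no free = inj₁ (ok-free u∈ (proj₁ (js-needed j∈)) free)
          ... | yes uj = inj₂ (ok-free v∈ (proj₁ (js-needed j∈)) λ vj → u≢v (unique-parent uj vj))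

          open Assignment (assign _≟_ ok? h₀ ρ js us us! js<us choice)

          h-valid : ∀ {u} → IsChild p u → h u ≢ k × Valid u (h u)
          h-valid {u} pu with legal u
          ... | inj₁ eq rewrite eq = h₀-valid pu
          ... | inj₂ (_ , ok) = ok

          covered : ∀ j → j ≢ k → ∃[ u ] IsChild p u × h u ≡ j
          covered j j≢k with isChild? p (x j) | j ≟ᶠ ρ
          ... | yes pj | _ = x j , pj , proj₁ (proj₂ (h-valid pj)) refl
          ... | no _ | yes refl =
            let u , u∈ , eq = covers′ (λ u∈ → ok-free u∈ j≢k not-child-r) in
            u , proj₁ (us-free u∈) , eq
          ... | no ¬pj | no j≢ρ =
            let u , u∈ , eq = covers (∈-filter⁺ needed? (∈-allFin j) (j≢k , j≢ρ , ¬pj)) in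
            u , proj₁ (us-free u∈) , eq

        extendSelected : ∃ (Extends p k)
        extendSelected = h , h-valid , λ _ → covered

      extend : ∃ (Extends p k)
      extend with selected? p
      ... | no unselected = extendUnselected unselected
      ... | yes (i , eq) = extendSelected (trans (cong x (proj₁ k-valid eq)) eq)

    Processed : (V → Colour) → V → Set
    Processed c p = (∀ {u} → IsChild p u → c u ≢ c p) ×
                    (∀ {i} → x i ≡ p → ∀ j → j ≢ c p → ∃[ u ] IsChild p u × c u ≡ j)

    -- Recolouring the children of `p` disturbs no vertex processed earlier: they have no other
    -- parent and rank above `p`.
    sweep : ∀ n → ∃ λ (c : V → Colour) → (∀ v → Valid v (c v)) × (∀ {p} → rank p < n → Processed c p)
    sweep zero = proj₁ ∘ initial , proj₂ ∘ initial , λ ()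
    sweep (suc n) with sweep n | anyVertex? G (λ p → rank p ≟ⁿ n)
    ... | c , valid , processed | no none =
      c , valid , λ p<1+n → processed (≤∧≢⇒< (s≤s⁻¹ p<1+n) λ eq → none (_ , eq))
    ... | c , valid , processed | yes (p , refl) with extend (valid p)
    ... | h , h-valid , h-covers = c′ , valid′ , processed′
      where
      c′ : V → Colour
      c′ v with isChild? p v
      ... | yes _ = h v
      ... | no _  = c v

      c′-child : ∀ {v} → IsChild p v → c′ v ≡ h v
      c′-child {v} pv with isChild? p v
      ... | yes _  = refl
      ... | no ¬pv = contradiction pv ¬pv

      c′-other : ∀ {v} → ¬ IsChild p v → c′ v ≡ c v
      c′-other {v} ¬pv with isChild? p v
      ... | yes pv = contradiction pv ¬pv
      ... | no _   = refl

      valid′ : ∀ v → Valid v (c′ v)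
      valid′ v with isChild? p v
      ... | yes pv = proj₂ (h-valid pv)
      ... | no _   = valid v

      processed′ : ∀ {q} → rank q < suc (rank p) → Processed c′ q
      processed′ {q} q<1+p with q ≟ p
      ... | yes refl =
        (λ pu eq → proj₁ (h-valid pu) (trans (sym (c′-child pu)) (trans eq (c′-other not-self-child)))) ,
        λ xi≡p j j≢ →
          let u , pu , eq = h-covers xi≡p j (λ j≡cp → j≢ (trans j≡cp (sym (c′-other not-self-child)))) in
          u , pu , trans (c′-child pu) eq
      ... | no q≢p =
        (λ qu eq → proj₁ done qu (trans (sym (c′u qu)) (trans eq c′q))) ,
        λ xi≡q j j≢ →
          let u , qu , eq = proj₂ done xi≡q j (λ j≡cq → j≢ (trans j≡cq (sym c′q))) in
          u , qu , trans (c′u qu) eq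
        where
        done : Processed c q
        done = processed (≤∧≢⇒< (s≤s⁻¹ q<1+p) (q≢p ∘ rank-injective))

        c′u : ∀ {u} → IsChild q u → c′ u ≡ c u
        c′u qu = c′-other λ pu → q≢p (unique-parent qu pu)

        c′q : c′ q ≡ c q
        c′q = c′-other λ pq → 1+n≰n (≤-trans (proj₂ pq) (s≤s⁻¹ q<1+p))

    bColorable : BColorable G (suc s)
    bColorable with sweep bound
    ... | c , valid , processed = c , proper , dominated
      where
      proper : IsProper G c
      proper {u} {v} uv eq with adj⇒child uv
      ... | inj₁ uv = proj₁ (processed (bounded u)) uv (sym eq)
      ... | inj₂ vu = proj₁ (processed (bounded v)) vu eq

      dominated : ∀ i → Dominated G c i
      dominated i = x i , proj₁ (valid (x i)) refl , λ j j≢ →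
        let u , child , eq = proj₂ (processed (bounded (x i))) refl j j≢ in u , proj₁ child , eq

-- A b-vertex under `2 + s` colours has neighbours in `suc s` other classes, hence is dense. One of
-- these vertices, `g zero`, serves as the root.
tree-downStep : ∀ {G} → IsTree G → DownStep G
tree-downStep ((v , _) , _) zero (c₀ , _) _ with c₀ v
... | ()
tree-downStep {G} (_ , acyclic) (suc s) colorable (c , proper , dominated) =
  bColorable (g-dense zero) (select g-inj g-dense (suc s) (n≤1+n _))
  where
  g : Fin (2 + s) → Vertex G
  g = proj₁ ∘ dominated

  cg : ∀ i → c (g i) ≡ i
  cg i = proj₁ (proj₂ (dominated i))

  g-inj : ∀ {i j} → g i ≡ g j → i ≡ j
  g-inj {i} {j} eq = trans (sym (cg i)) (trans (cong c eq) (cg j))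

  open ForestColouring G (eliminationOrder G acyclic _ ≤-refl (∈-vertices G (g zero))) colorable

  g-dense : ∀ i → Dense (g i)
  g-dense i = dense (proj₁ ∘ nbr)
    (λ {j} {k} eq → punchIn-injective (c (g i)) j k
      (trans (sym (proj₂ (proj₂ (nbr j)))) (trans (cong c eq) (proj₂ (proj₂ (nbr k))))))
    (λ j → proj₁ (proj₂ (nbr j)))
    where
    nbr : ∀ j → ∃[ w ] Adj G (g i) w × c w ≡ punchIn (c (g i)) j
    nbr j = proj₂ (proj₂ (dominated i)) (punchIn (c (g i)) j) (punchInᵢ≢i (c (g i)) j)

-- Induction over tree-cographs

treeCograph-downStep : ∀ {G} → TreeCograph G → DownStep G
treeCograph-downStep {G} (tree t)   = tree-downStep {G} t
treeCograph-downStep {G} (cotree t) = coTree-downStep {G} t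
treeCograph-downStep {G} (union {G₁} {G₂} t₁ t₂ iso) = DownStep-≅ {G} {G₁ ∪ G₂} iso
  (∪-downStep {G₁} {G₂} (treeCograph-downStep t₁) (treeCograph-downStep t₂))
treeCograph-downStep {G} (join {G₁} {G₂} t₁ t₂ iso) = DownStep-≅ {G} {G₁ ∨ G₂} iso
  (∨-downStep {G₁} {G₂} (treeCograph-downStep t₁) (treeCograph-downStep t₂))

theorem18 : (G : Graph) → TreeCograph G → BContinuous G
theorem18 G t = downStep⇒bContinuous {G} (treeCograph-downStep t)
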